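{- Let $X_4$ be the affine surface $x_4^2-2x_3^2+x_2^2=x_3^2-2x_2^2+x_1^2=2$ and let $\zeta=\varphi\tau\mu_{14}$ be the birational map on $X_4$ defined in the context. For any $t\in\mathbb{Z}$ and any non-negative integer $n$, the $n$-th iterate $$\zeta^{(n)}(t,t+1,t+2,t+3)$$ has the form $$\xi(n,t)=(\xi_1(n,t),\xi_2(n,t),\xi_3(n,t),\xi_4(n,t)),$$ where each $\xi_i(n,t)$ is a polynomial in $t$ of degree $2n+1$.
   Context: $X_4$ is the affine variety over $\mathbb{Q}$ in coordinates $(x_1,x_2,x_3,x_4)$ defined by $x_4^2-2x_3^2+x_2^2=2$ and $x_3^2-2x_2^2+x_1^2=2$. Rational maps on $X_4$ are, as usual, identified when they agree on a dense open subset of $X_4$; a rational map is defined at a point as soon as some representative (expression by rational functions agreeing with it on a dense open subset of $X_4$) is regular at that point. Products of maps denote composition, and $\zeta^{(n)}$ is the $n$-fold composition of $\zeta$ with itself ($\zeta^{(0)}$ is the identity). Let $\tau(a,b,c,d)=(d,c,b,a)$ and $\mu_{14}(a,b,c,d)=(-a,b,c,-d)$. Let $\varphi=\left(\frac{p_1}{q},\frac{p_2}{q},\frac{p_3}{q},\frac{p_4}{q}\right)$, where, in the variables $(a,b,c,d)$, $$q=(b-c)^2(a-2b+c),$$ $$p_1=-2ab^3+ab^2c+2ab^2d+4abc^2-5abcd+ab-2ac^3+2ac^2d+ac-ad+3b^4-2b^3c-3b^3d-6b^2c^2+8b^2cd+b^2+4bc^3-4bc^2d-5bc+bd+c^2+cd-2,$$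 $$p_2=-2ab^2c+5abc^2-2abcd+2ab-2ac^3+ac^2d-ad+3b^3c-8b^2c^2+3b^2cd-2b^2+4bc^3-2bc^2d-bc+2bd-2,$$ $$p_3=-2ab^3+5ab^2c-2ab^2d-2abc^2+abcd+3ab-ac-ad+3b^4-8b^3c+3b^3d+4b^2c^2-2b^2cd-3b^2-bc+3bd+c^2-cd-2,$$ $$p_4=-3ab^3+8ab^2c-3ab^2d-4abc^2+2abcd+4ab-2ac-ad+4b^4-10b^3c+4b^3d+2b^2c^2-2b^2cd-4b^2+5bc^3-2bc^2d-bc+4bd-2c^4+c^3d+2c^2-2cd-2.$$ Then $\varphi$ is a birational map on $X_4$, and $\zeta=\varphi\tau\mu_{14}$, i.e. $\zeta(a,b,c,d)=\varphi(-d,c,b,-a)$. -}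

module Defs where

open import Algebra.Bundles.Raw using (RawRing)
open import Data.Fin.Base using (Fin)
open import Data.Fin.Patterns using (0F; 1F; 2F; 3F)
open import Data.Integer.Base using (ℤ; +_)
open import Data.Nat.Base using (ℕ; zero; suc)
open import Data.Product.Base using (Σ; _×_; ∃-syntax)
open import Data.Rational.Base as ℚ using (ℚ; 0ℚ; 1ℚ)
open import Data.Rational.Solver using (module +-*-Solver)
open import Data.Vec.Base using (Vec; []; _∷_; lookup; map; foldr; last)
open import Function.Base using (id)
open import Level using (0ℓ)
open import Relation.Binary.PropositionalEquality using (_≡_; _≢_; refl)
open import Tactic.RingSolver.Core.Expression
  using (Expr; Κ; Ι; module Eval)
  renaming (_⊕_ to infixl 6 _+_; _⊗_ to infixl 7 _*_; _⊛_ to infixr 8 _^_; ⊝_ to infix 8 -_)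

-- Polynomials in the coordinates (x₁ , x₂ , x₃ , x₄) = (a , b , c , d), as
-- expressions; which expressions are equal is decided by _≈_ below.

Poly : Set
Poly = Expr ℚ 4

pattern a = Ι 0F
pattern b = Ι 1F
pattern c = Ι 2F
pattern d = Ι 3F

infixl 6 _-_
infixl 7 _·_

_-_ : Poly → Poly → Poly
p - q = p + (- q)

0ᵖ 1ᵖ : Poly
0ᵖ = Κ 0ℚ
1ᵖ = Κ 1ℚ

_·_ : ℕ → Poly → Poly
n · p = Κ (+ n ℚ./ 1) * p

-- Equality in the coordinate ring ℚ[X₄] = ℚ[a,b,c,d] / (X₄-eq₁ , X₄-eq₂),
-- presented by the commutative ℚ-algebra laws together with the two
-- defining equations of X₄.

infix 4 _≈_

data _≈_ : Poly → Poly → Set where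
  ≈-refl  : ∀ {p} → p ≈ p
  ≈-sym   : ∀ {p q} → p ≈ q → q ≈ p
  ≈-trans : ∀ {p q r} → p ≈ q → q ≈ r → p ≈ r

  +-cong  : ∀ {p p′ q q′} → p ≈ p′ → q ≈ q′ → p + q ≈ p′ + q′
  *-cong  : ∀ {p p′ q q′} → p ≈ p′ → q ≈ q′ → p * q ≈ p′ * q′
  -‿cong  : ∀ {p p′} → p ≈ p′ → - p ≈ - p′

  +-assoc     : ∀ p q r → (p + q) + r ≈ p + (q + r)
  +-comm      : ∀ p q → p + q ≈ q + p
  +-identityˡ : ∀ p → 0ᵖ + p ≈ p
  -‿inverseˡ  : ∀ p → (- p) + p ≈ 0ᵖ
  *-assoc     : ∀ p q r → (p * q) * r ≈ p * (q * r)
  *-comm      : ∀ p q → p * q ≈ q * p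
  *-identityˡ : ∀ p → 1ᵖ * p ≈ p
  distribˡ    : ∀ p q r → p * (q + r) ≈ p * q + p * r

  ^-zero : ∀ p → p ^ 0 ≈ 1ᵖ
  ^-suc  : ∀ p n → p ^ suc n ≈ p * p ^ n

  Κ-+ : ∀ r s → Κ (r ℚ.+ s) ≈ Κ r + Κ s
  Κ-* : ∀ r s → Κ (r ℚ.* s) ≈ Κ r * Κ s

  X₄-eq₁ : d ^ 2 - 2 · c ^ 2 + b ^ 2 ≈ 2 · 1ᵖ
  X₄-eq₂ : c ^ 2 - 2 · b ^ 2 + a ^ 2 ≈ 2 · 1ᵖ

-- Zariski topology of X₄.  D(h) denotes the principal open subset {h ≠ 0}.
-- A polynomial vanishes everywhere on X₄ iff it is nilpotent in ℚ[X₄], so: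
--   Vanishes h        says that D(h) is empty;
--   Vanishes (h * p)  says that p is zero on D(h), and also that
--                     D(h) ∩ D(p) is empty.

Vanishes : Poly → Set
Vanishes p = ∃[ m ] p ^ m ≈ 0ᵖ

-- D(h) is dense: an open subset disjoint from it is empty.  (It suffices to
-- test the basic open subsets D(k).)

Dense : Poly → Set
Dense h = ∀ k → Vanishes (h * k) → Vanishes k

-- Quotients num / den of polynomials.  Such a quotient represents a rational
-- function on X₄ when D(den) is dense; this is not a field of the record, but
-- it is enforced by _∼_.

infix 4 _//_

record Quotient : Set where
  constructor _//_
  field
    num den : Poly

open Quotient

-- f ∼ g: f and g agree on a dense open subset of X₄, which can be taken to be
-- principal and contained in D(den f) ∩ D(den g), hence of the form
-- D(h * den f * den g).

infix 4 _∼_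

_∼_ : Quotient → Quotient → Set
f ∼ g = ∃[ h ] let u = h * den f * den g in
  Dense u × Vanishes (u * (num f * den g - num g * den f))

quotientRawRing : RawRing 0ℓ 0ℓ
quotientRawRing = record
  { Carrier = Quotient
  ; _≈_     = _∼_
  ; _+_     = λ f g → num f * den g + num g * den f // den f * den g
  ; _*_     = λ f g → num f * num g // den f * den g
  ; -_      = λ f → - num f // den f
  ; 0#      = 0ᵖ // 1ᵖ
  ; 1#      = 1ᵖ // 1ᵖ
  }

infixl 7 _÷_

_÷_ : Quotient → Quotient → Quotient
f ÷ g = num f * den g // den f * num g

-- Rational maps from X₄ to affine 4-space, by coordinates.

RatMap : Set
RatMap = Vec Quotient 4

infix 4 _≋_

_≋_ : RatMap → RatMap → Set
F ≋ G = ∀ i → lookup F i ∼ lookup G i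

-- p [ G ] is p with the coordinates of G substituted for a, b, c, d.

_[_] : Poly → RatMap → Quotient
p [ G ] = Eval.⟦_⟧ quotientRawRing (λ r → Κ r // 1ᵖ) p G

infixr 9 _⊚_

_⊚_ : RatMap → RatMap → RatMap
F ⊚ G = map (λ f → num f [ G ] ÷ den f [ G ]) F

idᵣ : RatMap
idᵣ = (a // 1ᵖ) ∷ (b // 1ᵖ) ∷ (c // 1ᵖ) ∷ (d // 1ᵖ) ∷ []

_⁽_⁾ : RatMap → ℕ → RatMap
F ⁽ zero ⁾  = idᵣ
F ⁽ suc n ⁾ = F ⊚ (F ⁽ n ⁾)

-- Rational points of X₄, and values of rational maps at them.

⟦_⟧ : Poly → Vec ℚ 4 → ℚ
⟦_⟧ = Eval.⟦_⟧ ℚ.+-*-rawRing id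

record Point : Set where
  constructor point
  field
    coords : Vec ℚ 4
    on-X₄₁ : ⟦ d ^ 2 - 2 · c ^ 2 + b ^ 2 ⟧ coords ≡ ⟦ 2 · 1ᵖ ⟧ coords
    on-X₄₂ : ⟦ c ^ 2 - 2 · b ^ 2 + a ^ 2 ⟧ coords ≡ ⟦ 2 · 1ᵖ ⟧ coords

open Point

-- F is defined at P with value v: some representative R of F is regular at P,
-- and its value there is v.

_at_hasValue_ : RatMap → Point → Vec ℚ 4 → Set
F at P hasValue v = Σ RatMap λ R → (R ≋ F) ×
  (∀ i → let f = lookup R i in
    ⟦ den f ⟧ (coords P) ≢ 0ℚ ×
    ⟦ num f ⟧ (coords P) ≡ lookup v i ℚ.* ⟦ den f ⟧ (coords P))

τ μ₁₄ φ ζ : RatMap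

τ = (d // 1ᵖ) ∷ (c // 1ᵖ) ∷ (b // 1ᵖ) ∷ (a // 1ᵖ) ∷ []

μ₁₄ = (- a // 1ᵖ) ∷ (b // 1ᵖ) ∷ (c // 1ᵖ) ∷ (- d // 1ᵖ) ∷ []

q : Poly
q = (b - c) ^ 2 * (a - 2 · b + c)

p₁ : Poly
p₁ = - (2 · a * b ^ 3) + a * b ^ 2 * c + 2 · a * b ^ 2 * d + 4 · a * b * c ^ 2
      - 5 · a * b * c * d + a * b - 2 · a * c ^ 3 + 2 · a * c ^ 2 * d + a * c - a * d
      + 3 · b ^ 4 - 2 · b ^ 3 * c - 3 · b ^ 3 * d - 6 · b ^ 2 * c ^ 2
      + 8 · b ^ 2 * c * d + b ^ 2 + 4 · b * c ^ 3 - 4 · b * c ^ 2 * d - 5 · b * c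
      + b * d + c ^ 2 + c * d - 2 · 1ᵖ

p₂ : Poly
p₂ = - (2 · a * b ^ 2 * c) + 5 · a * b * c ^ 2 - 2 · a * b * c * d + 2 · a * b
      - 2 · a * c ^ 3 + a * c ^ 2 * d - a * d + 3 · b ^ 3 * c - 8 · b ^ 2 * c ^ 2
      + 3 · b ^ 2 * c * d - 2 · b ^ 2 + 4 · b * c ^ 3 - 2 · b * c ^ 2 * d - b * c
      + 2 · b * d - 2 · 1ᵖ

p₃ : Poly
p₃ = - (2 · a * b ^ 3) + 5 · a * b ^ 2 * c - 2 · a * b ^ 2 * d - 2 · a * b * c ^ 2
      + a * b * c * d + 3 · a * b - a * c - a * d + 3 · b ^ 4 - 8 · b ^ 3 * c
      + 3 · b ^ 3 * d + 4 · b ^ 2 * c ^ 2 - 2 · b ^ 2 * c * d - 3 · b ^ 2 - b * c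
      + 3 · b * d + c ^ 2 - c * d - 2 · 1ᵖ

p₄ : Poly
p₄ = - (3 · a * b ^ 3) + 8 · a * b ^ 2 * c - 3 · a * b ^ 2 * d - 4 · a * b * c ^ 2
      + 2 · a * b * c * d + 4 · a * b - 2 · a * c - a * d + 4 · b ^ 4 - 10 · b ^ 3 * c
      + 4 · b ^ 3 * d + 2 · b ^ 2 * c ^ 2 - 2 · b ^ 2 * c * d - 4 · b ^ 2
      + 5 · b * c ^ 3 - 2 · b * c ^ 2 * d - b * c + 4 · b * d - 2 · c ^ 4 + c ^ 3 * d
      + 2 · c ^ 2 - 2 · c * d - 2 · 1ᵖ

φ = (p₁ // q) ∷ (p₂ // q) ∷ (p₃ // q) ∷ (p₄ // q) ∷ []

ζ = φ ⊚ τ ⊚ μ₁₄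

ι : ℤ → ℚ
ι t = t ℚ./ 1

-- The point (t , t + 1 , t + 2 , t + 3).

line : ℤ → Point
line t = point (x ∷ x ℚ.+ one ∷ x ℚ.+ two ∷ x ℚ.+ three ∷ [])
    (solve 1 (λ y →
       (y :+ con three) :* (y :+ con three)
         :+ :- (con two :* ((y :+ con two) :* (y :+ con two)))
         :+ (y :+ con one) :* (y :+ con one)
       := con two :* con one) refl x)
    (solve 1 (λ y →
       (y :+ con two) :* (y :+ con two)
         :+ :- (con two :* ((y :+ con one) :* (y :+ con one)))
         :+ y :* y
       := con two :* con one) refl x)
  where
  open +-*-Solver
  x one two three : ℚ
  x     = ι t
  one   = 1ℚ
  two   = + 2 ℚ./ 1
  three = + 3 ℚ./ 1

-- Univariate polynomials over ℚ of degree exactly n, by their coefficients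
-- starting from the constant one.

record PolynomialOfDegree (n : ℕ) : Set where
  field
    coefficients : Vec ℚ (suc n)
    leading≢0    : last coefficients ≢ 0ℚ

evaluate : ∀ {n} → PolynomialOfDegree n → ℚ → ℚ
evaluate p x =
  foldr (λ _ → ℚ) (λ k r → k ℚ.+ x ℚ.* r) 0ℚ (PolynomialOfDegree.coefficients p)

{-# OPTIONS --safe #-}

-- X₄ is fibred in conics by s = (a + d) / (c - b): in the coordinates u = c - b and
-- w = (d - a) / 3 the fibre is (s² - 1) u² + (9 - s²) w² = 8, and s w = b + c.  On it ζ is the
-- linear map of determinant 1
--   u′ = ((s² - 5) u + (s² - 9) w) / 4,   w′ = ((s² - 1) u + (s² - 5) w) / 4,
-- so the iterates of ζ are polynomials in s, u and w, regular where c ≠ b.  Along the line,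
-- s = 2t + 3 and u = w = 1, and the coefficient of t²ⁿ in u and w is 2ⁿ after n steps.
--
-- That the denominators of the iterates are dense on X₄ is proved in a power series model.
-- With u and b + c expanded at ½ and 1, the coordinate ring ℚ[X₄] embeds in
-- ℚ[[x, y]][√a²][√d²].  There an element is regular if its norm has nonzero constant term,
-- i.e. if it does not vanish at any of the four points (±5/4, 1/4, 3/4, ±7/4), where s is
-- ±1 or ±6 and a sign argument controls the orbit.

module Submission where

open import Algebra.Bundles using (CommutativeRing; RawRing)
import Algebra.Definitions.RawSemiring as RawSemiring
import Algebra.Properties.Semiring.Exp.TCOptimised as Exp
open import Data.Bool.Base using (Bool; true; false; T)
open import Data.Fin.Base using (Fin)
open import Data.Fin.Patterns using (0F; 1F; 2F; 3F; 4F; 5F; 6F)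
open import Data.Integer.Base using (+_)
open import Data.Maybe.Base using (nothing)
open import Data.Nat.Base using (ℕ; zero; suc)
open import Data.Nat.Properties as ℕ using ()
open import Data.Product.Base using (_×_; _,_; proj₁; proj₂; ∃-syntax)
open import Data.Rational.Base as ℚ using (ℚ; 0ℚ; 1ℚ; ½; Positive; NonNegative)
open import Data.Rational.Properties as ℚ using ()
open import Data.Sum.Base using (inj₁; inj₂)
open import Data.Vec.Base using (Vec; []; _∷_; lookup; map; foldr; last)
open import Data.Vec.Properties using (lookup-map)
open import Function.Base using (id; _∘_)
open import Level using (0ℓ)
open import Relation.Binary.PropositionalEquality as ≡ using (_≡_; _≢_; refl)
open import Relation.Binary.Structures using (IsEquivalence)
open import Relation.Nullary using (yes)
open import Relation.Nullary.Decidable using (isYes)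
open import Tactic.RingSolver.Core.AlmostCommutativeRing as ACR using ()
open import Tactic.RingSolver.Core.Expression
import Tactic.RingSolver.Core.Polynomial.Base as Normal
import Tactic.RingSolver.Core.Polynomial.Homomorphism as Correctness
open import Tactic.RingSolver.Core.Polynomial.Parameters using (RawCoeff; Homomorphism)
import Tactic.RingSolver.Core.Polynomial.Semantics as Semantics
import Defs
open import Defs using (Poly; Quotient; _//_; RatMap; _⊚_; quotientRawRing; _⁽_⁾)
open Quotient using (num; den)

-- ℚ-algebras and polynomial identities

-- The formula for ζ breaks down on the line itself: at t = -3 the factor s + 3 of its denominator
-- is zero. Values there must be read off another representative, `iterate n`, and the two must be
-- shown to agree although the n-fold composite is far too large to expand. Both are compared
-- through their common value at a generic point of X₄, whose coordinates lie in a larger ring; the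
-- same notion of value, taken over ℚ, later gives the values on the line. Density of a denominator
-- follows once it is a non-zero-divisor in ℚ[X₄], a ring presented only by generators and
-- relations. A nonzero value at a point does not by itself exclude zero divisors in such a ring;
-- over power series it does. Injectivity of the embedding is obtained without normal forms in
-- ℚ[X₄]: a partial map backwards pairs the generic point with the coordinates, and pairs zero only
-- with zero. The sign argument: on a fibre with s² = 1 or s² = 36 the product u w stays positive
-- once it is positive, which keeps u and u + w away from zero, while s + 3 is constant along the
-- orbit.

record CommutativeRingLaws (R : RawRing 0ℓ 0ℓ) : Set where
  open RawRing R
  field
    isEquivalence : IsEquivalence _≈_
    +-cong      : ∀ {x x′ y y′} → x ≈ x′ → y ≈ y′ → x + y ≈ x′ + y′
    *-cong      : ∀ {x x′ y y′} → x ≈ x′ → y ≈ y′ → x * y ≈ x′ * y′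
    -‿cong      : ∀ {x x′} → x ≈ x′ → - x ≈ - x′
    +-assoc     : ∀ x y z → (x + y) + z ≈ x + (y + z)
    +-comm      : ∀ x y → x + y ≈ y + x
    +-identityˡ : ∀ x → 0# + x ≈ x
    -‿inverseˡ  : ∀ x → (- x) + x ≈ 0#
    *-assoc     : ∀ x y z → (x * y) * z ≈ x * (y * z)
    *-comm      : ∀ x y → x * y ≈ y * x
    *-identityˡ : ∀ x → 1# * x ≈ x
    distribˡ    : ∀ x y z → x * (y + z) ≈ x * y + x * z

  private module E = IsEquivalence isEquivalence

  commutativeRing : CommutativeRing 0ℓ 0ℓ
  commutativeRing = record
    { isCommutativeRing = record
      { isRing = record
        { +-isAbelianGroup = record
          { isGroup = record
            { isMonoid = record
              { isSemigroup = record
                { isMagma = record { isEquivalence = isEquivalence ; ∙-cong = +-cong }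
                ; assoc = +-assoc }
              ; identity = +-identityˡ , λ x → E.trans (+-comm x _) (+-identityˡ x) }
            ; inverse = -‿inverseˡ , λ x → E.trans (+-comm x _) (-‿inverseˡ x)
            ; ⁻¹-cong = -‿cong }
          ; comm = +-comm }
        ; *-cong = *-cong
        ; *-assoc = *-assoc
        ; *-identity = *-identityˡ , λ x → E.trans (*-comm x _) (*-identityˡ x)
        ; distrib = distribˡ , λ x y z → E.trans (*-comm _ x)
            (E.trans (distribˡ x y z) (+-cong (*-comm x y) (*-comm x z))) }
      ; *-comm = *-comm } }

record ℚ-Algebra : Set₁ where
  field
    commutativeRing : CommutativeRing 0ℓ 0ℓ
  open CommutativeRing commutativeRing public hiding (zero)
    renaming (refl to ≈-refl; sym to ≈-sym; trans to ≈-trans; reflexive to ≈-reflexive)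
  open RawRing rawRing public using (rawSemiring)
  field
    κ   : ℚ → Carrier
    κ-+ : ∀ r s → κ (r ℚ.+ s) ≈ κ r + κ s
    κ-* : ∀ r s → κ (r ℚ.* s) ≈ κ r * κ s
    κ-- : ∀ r → κ (ℚ.- r) ≈ - κ r
    κ-0 : κ 0ℚ ≈ 0#
    κ-1 : κ 1ℚ ≈ 1#

  open Eval rawRing κ public

  _Regular : Carrier → Set
  x Regular = ∀ y → x * y ≈ 0# → y ≈ 0#

rational : ℕ → ℚ
rational k = + k ℚ./ 1

nat : ∀ {n} → ℕ → Expr ℚ n
nat k = Κ (rational k)

ℚ-algebra : ℚ-Algebra
ℚ-algebra = record
  { commutativeRing = ℚ.+-*-commutativeRing ; κ = id
  ; κ-+ = λ _ _ → refl ; κ-* = λ _ _ → refl ; κ-- = λ _ → refl ; κ-0 = refl ; κ-1 = refl }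

module _ {A : Set} (R S : RawRing 0ℓ 0ℓ)
  {κᴿ : A → RawRing.Carrier R} {κˢ : A → RawRing.Carrier S}
  (_~_ : RawRing.Carrier R → RawRing.Carrier S → Set)
  where
  private
    module R = RawRing R
    module S = RawRing S
    module Rᵉ = Eval R κᴿ
    module Sᵉ = Eval S κˢ
    open RawSemiring R.rawSemiring using () renaming (_^′_ to _^ᴿ_)
    open RawSemiring S.rawSemiring using () renaming (_^′_ to _^ˢ_)

  module _
    (+-rel : ∀ {x x′ y y′} → x ~ x′ → y ~ y′ → (x R.+ y) ~ (x′ S.+ y′))
    (*-rel : ∀ {x x′ y y′} → x ~ x′ → y ~ y′ → (x R.* y) ~ (x′ S.* y′))
    (neg-rel : ∀ {x x′} → x ~ x′ → (R.- x) ~ (S.- x′))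
    (1-rel : R.1# ~ S.1#)
    (κ-rel : ∀ r → κᴿ r ~ κˢ r)
    where

    private
      ^-rel : ∀ {x x′} n → x ~ x′ → (x ^ᴿ n) ~ (x′ ^ˢ n)
      ^-rel zero          x~x′ = 1-rel
      ^-rel (suc zero)    x~x′ = x~x′
      ^-rel (suc (suc n)) x~x′ = *-rel (^-rel (suc n) x~x′) x~x′

    -- Induction on the expression, stated for raw operations because one of the rings it serves is
    -- the raw ring of quotients, where `_∼_` fails to be reflexive at a zero denominator. The same
    -- induction covers substitution, homomorphisms, partial homomorphisms and values of quotients.
    eval-rel : ∀ {n} (e : Expr A n) {ρ : Vec R.Carrier n} {ρ′ : Vec S.Carrier n} →
               (∀ i → lookup ρ i ~ lookup ρ′ i) → Rᵉ.⟦ e ⟧ ρ ~ Sᵉ.⟦ e ⟧ ρ′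
    eval-rel (Κ r)   ρ~ρ′ = κ-rel r
    eval-rel (Ι i)   ρ~ρ′ = ρ~ρ′ i
    eval-rel (e ⊕ f) ρ~ρ′ = +-rel (eval-rel e ρ~ρ′) (eval-rel f ρ~ρ′)
    eval-rel (e ⊗ f) ρ~ρ′ = *-rel (eval-rel e ρ~ρ′) (eval-rel f ρ~ρ′)
    eval-rel (e ⊛ n) ρ~ρ′ = ^-rel n (eval-rel e ρ~ρ′)
    eval-rel (⊝ e)   ρ~ρ′ = neg-rel (eval-rel e ρ~ρ′)

private
  ℚ-coefficients : RawCoeff 0ℓ 0ℓ
  ℚ-coefficients = record { rawRing = ℚ.+-*-rawRing ; isZero = λ r → isYes (0ℚ ℚ.≟ r) }

  module Norm = Normal ℚ-coefficients

norm : ∀ {n} → Expr ℚ n → Norm.Poly n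
norm (Κ r)   = Norm.κ r
norm (Ι i)   = Norm.ι i
norm (e ⊕ f) = norm e Norm.⊞ norm f
norm (e ⊗ f) = norm e Norm.⊠ norm f
norm (e ⊛ n) = norm e Norm.⊡ n
norm (⊝ e)   = Norm.⊟ norm e

substitute : ∀ {m n} → Expr ℚ m → Vec (Expr ℚ n) m → Expr ℚ n
substitute {n = n} = Eval.⟦_⟧ expressions Κ
  where
  expressions : RawRing 0ℓ 0ℓ
  expressions = record
    { Carrier = Expr ℚ n ; _≈_ = _≡_ ; _+_ = _⊕_ ; _*_ = _⊗_ ; -_ = ⊝_ ; 0# = Κ 0ℚ ; 1# = Κ 1ℚ }

module Solver (B : ℚ-Algebra) where
  open ℚ-Algebra B

  eval-substitute : ∀ {m n} (e : Expr ℚ m) (es : Vec (Expr ℚ n) m) (ρ : Vec Carrier n) →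
                    ⟦ substitute e es ⟧ ρ ≈ ⟦ e ⟧ (map (λ e → ⟦ e ⟧ ρ) es)
  eval-substitute e es ρ =
    eval-rel _ rawRing (λ e x → ⟦ e ⟧ ρ ≈ x) +-cong *-cong -‿cong κ-1 (λ _ → ≈-refl) e
      (λ i → ≈-reflexive (≡.sym (lookup-map i _ es)))

  private
    homomorphism : Homomorphism 0ℓ 0ℓ 0ℓ 0ℓ
    homomorphism = record
      { from = ℚ-coefficients
      ; to = ACR.fromCommutativeRing commutativeRing (λ _ → nothing)
      ; morphism = record
        { ⟦_⟧ = κ ; +-homo = κ-+ ; *-homo = κ-* ; -‿homo = κ-- ; 0-homo = κ-0 ; 1-homo = κ-1 }
      ; Zero-C⟶Zero-R = zero-sound
      }
      where
      zero-sound : ∀ r → T (isYes (0ℚ ℚ.≟ r)) → 0# ≈ κ r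
      zero-sound r t with 0ℚ ℚ.≟ r
      ... | yes refl = ≈-sym κ-0

    module Sem = Semantics homomorphism
    module Hom = Correctness homomorphism

    correct : ∀ {n} (e : Expr ℚ n) ρ → Sem.⟦ norm e ⟧ ρ ≈ ⟦ e ⟧ ρ
    correct (Κ r)   ρ = Hom.κ-hom r ρ
    correct (Ι i)   ρ = Hom.ι-hom i ρ
    correct (e ⊕ f) ρ = ≈-trans (Hom.⊞-hom (norm e) (norm f) ρ) (+-cong (correct e ρ) (correct f ρ))
    correct (e ⊗ f) ρ = ≈-trans (Hom.⊠-hom (norm e) (norm f) ρ) (*-cong (correct e ρ) (correct f ρ))
    correct (⊝ e)   ρ = ≈-trans (Hom.⊟-hom (norm e) ρ) (-‿cong (correct e ρ))
    correct (e ⊛ n) ρ = ≈-trans (Hom.⊡-hom (norm e) n ρ) (Exp.^-congˡ semiring n (correct e ρ))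

  -- Normal forms are computed over ℚ, so for concrete expressions the hypothesis is a closed
  -- equation that `refl` settles by computation, whatever the target algebra.
  solve : ∀ {n} (e f : Expr ℚ n) ρ → norm e ≡ norm f → ⟦ e ⟧ ρ ≈ ⟦ f ⟧ ρ
  solve e f ρ eq = ≈-trans (≈-sym (correct e ρ))
    (≈-trans (≈-reflexive (≡.cong (λ p → Sem.⟦ p ⟧ ρ) eq)) (correct f ρ))

-- Homomorphisms, total and partial

infix 4 _⟶_

record _⟶_ (A B : ℚ-Algebra) : Set where
  private
    module A = ℚ-Algebra A
    module B = ℚ-Algebra B
  field
    ⟦_⟧    : A.Carrier → B.Carrier
    cong   : ∀ {x y} → x A.≈ y → ⟦ x ⟧ B.≈ ⟦ y ⟧
    +-homo : ∀ x y → ⟦ x A.+ y ⟧ B.≈ ⟦ x ⟧ B.+ ⟦ y ⟧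
    *-homo : ∀ x y → ⟦ x A.* y ⟧ B.≈ ⟦ x ⟧ B.* ⟦ y ⟧
    -‿homo : ∀ x → ⟦ A.- x ⟧ B.≈ B.- ⟦ x ⟧
    κ-homo : ∀ r → ⟦ A.κ r ⟧ B.≈ B.κ r

  1-homo : ⟦ A.1# ⟧ B.≈ B.1#
  1-homo = B.≈-trans (cong (A.≈-sym A.κ-1)) (B.≈-trans (κ-homo 1ℚ) B.κ-1)

  0-homo : ⟦ A.0# ⟧ B.≈ B.0#
  0-homo = B.≈-trans (cong (A.≈-sym A.κ-0)) (B.≈-trans (κ-homo 0ℚ) B.κ-0)

  eval-homo : ∀ {n} (e : Expr ℚ n) {ρ : Vec A.Carrier n} {ρ′ : Vec B.Carrier n} →
              (∀ i → ⟦ lookup ρ i ⟧ B.≈ lookup ρ′ i) → ⟦ A.⟦ e ⟧ ρ ⟧ B.≈ B.⟦ e ⟧ ρ′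
  eval-homo = eval-rel A.rawRing B.rawRing (λ x y → ⟦ x ⟧ B.≈ y)
    (λ p q → B.≈-trans (+-homo _ _) (B.+-cong p q))
    (λ p q → B.≈-trans (*-homo _ _) (B.*-cong p q))
    (λ p → B.≈-trans (-‿homo _) (B.-‿cong p))
    1-homo κ-homo

infixr 9 _∘ʰ_
_∘ʰ_ : ∀ {A B C} → B ⟶ C → A ⟶ B → A ⟶ C
_∘ʰ_ {C = C} g f = record
  { ⟦_⟧    = λ x → g.⟦ f.⟦ x ⟧ ⟧
  ; cong   = λ p → g.cong (f.cong p)
  ; +-homo = λ x y → C.≈-trans (g.cong (f.+-homo x y)) (g.+-homo _ _)
  ; *-homo = λ x y → C.≈-trans (g.cong (f.*-homo x y)) (g.*-homo _ _)
  ; -‿homo = λ x → C.≈-trans (g.cong (f.-‿homo x)) (g.-‿homo _)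
  ; κ-homo = λ r → C.≈-trans (g.cong (f.κ-homo r)) (g.κ-homo r)
  }
  where
  module f = _⟶_ f
  module g = _⟶_ g
  module C = ℚ-Algebra C

-- A ring homomorphism from a subring of K to A, as a graph.
infix 4 _⇀_
record _⇀_ (K A : ℚ-Algebra) : Set₁ where
  private
    module K = ℚ-Algebra K
    module A = ℚ-Algebra A
  infix 4 _~_
  field
    _~_    : K.Carrier → A.Carrier → Set
    ~-resp : ∀ {x x′ p p′} → x K.≈ x′ → p A.≈ p′ → x ~ p → x′ ~ p′
    ~-+    : ∀ {x y p q} → x ~ p → y ~ q → x K.+ y ~ p A.+ q
    ~-*    : ∀ {x y p q} → x ~ p → y ~ q → x K.* y ~ p A.* q
    ~-neg  : ∀ {x p} → x ~ p → K.- x ~ A.- p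
    ~-κ    : ∀ r → K.κ r ~ A.κ r
    -- Single-valuedness in disguise: if x is paired with p and with q, then x - x is paired with p
    -- - q.
    ~-zero : ∀ {x p} → x ~ p → x K.≈ K.0# → p A.≈ A.0#

  ~-0 : K.0# ~ A.0#
  ~-0 = ~-resp K.κ-0 A.κ-0 (~-κ 0ℚ)

  ~-1 : K.1# ~ A.1#
  ~-1 = ~-resp K.κ-1 A.κ-1 (~-κ 1ℚ)

  ~-eval : ∀ {n} (e : Expr ℚ n) {ρ : Vec K.Carrier n} {ρ′ : Vec A.Carrier n} →
           (∀ i → lookup ρ i ~ lookup ρ′ i) → K.⟦ e ⟧ ρ ~ A.⟦ e ⟧ ρ′
  ~-eval = eval-rel K.rawRing A.rawRing _~_ ~-+ ~-* ~-neg ~-1 ~-κ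

constants : ∀ A → ℚ-algebra ⇀ A
constants A = record
  { _~_    = λ r p → p ≈ κ r
  ; ~-resp = λ { refl p≈p′ p≈r → ≈-trans (≈-sym p≈p′) p≈r }
  ; ~-+    = λ p q → ≈-trans (+-cong p q) (≈-sym (κ-+ _ _))
  ; ~-*    = λ p q → ≈-trans (*-cong p q) (≈-sym (κ-* _ _))
  ; ~-neg  = λ p → ≈-trans (-‿cong p) (≈-sym (κ-- _))
  ; ~-κ    = λ _ → ≈-refl
  ; ~-zero = λ { p refl → ≈-trans p κ-0 }
  }
  where open ℚ-Algebra A

-- Power series and quadratic extensions

module PowerSeries (K : ℚ-Algebra) where
  open ℚ-Algebra K
  open Solver K
  open import Relation.Binary.Reasoning.Setoid setoid

  Series : Set
  Series = ℕ → Carrier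

  infix  4 _≈ˢ_
  infixl 6 _+ˢ_
  infixl 7 _*ˢ_ _∙_

  _≈ˢ_ : Series → Series → Set
  f ≈ˢ g = ∀ n → f n ≈ g n

  const : Carrier → Series
  const x zero    = x
  const x (suc n) = 0#

  shift : Series → Series
  shift f zero    = 0#
  shift f (suc n) = f n

  _+ˢ_ _*ˢ_ : Series → Series → Series
  (f +ˢ g) n = f n + g n

  (f *ˢ g) zero    = f 0 * g 0
  (f *ˢ g) (suc n) = f 0 * g (suc n) + (f ∘ suc *ˢ g) n

  _∙_ : Carrier → Series → Series
  (x ∙ f) n = x * f n

  *ˢ-cong : ∀ {f f′ g g′} → f ≈ˢ f′ → g ≈ˢ g′ → f *ˢ g ≈ˢ f′ *ˢ g′
  *ˢ-cong p q zero    = *-cong (p 0) (q 0)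
  *ˢ-cong p q (suc n) = +-cong (*-cong (p 0) (q (suc n))) (*ˢ-cong (p ∘ suc) q n)

  *ˢ-distribˡ : ∀ f g h → f *ˢ (g +ˢ h) ≈ˢ f *ˢ g +ˢ f *ˢ h
  *ˢ-distribˡ f g h zero    = distribˡ _ _ _
  *ˢ-distribˡ f g h (suc n) = ≈-trans
    (+-cong ≈-refl (*ˢ-distribˡ (f ∘ suc) g h n))
    (solve (Ι 0F ⊗ (Ι 1F ⊕ Ι 2F) ⊕ (Ι 3F ⊕ Ι 4F)) ((Ι 0F ⊗ Ι 1F ⊕ Ι 3F) ⊕ (Ι 0F ⊗ Ι 2F ⊕ Ι 4F))
      (f 0 ∷ g (suc n) ∷ h (suc n) ∷ (f ∘ suc *ˢ g) n ∷ (f ∘ suc *ˢ h) n ∷ []) refl)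

  *ˢ-distribʳ : ∀ f g h → (f +ˢ g) *ˢ h ≈ˢ f *ˢ h +ˢ g *ˢ h
  *ˢ-distribʳ f g h zero    = distribʳ _ _ _
  *ˢ-distribʳ f g h (suc n) = ≈-trans
    (+-cong ≈-refl (*ˢ-distribʳ (f ∘ suc) (g ∘ suc) h n))
    (solve ((Ι 1F ⊕ Ι 2F) ⊗ Ι 0F ⊕ (Ι 3F ⊕ Ι 4F)) ((Ι 1F ⊗ Ι 0F ⊕ Ι 3F) ⊕ (Ι 2F ⊗ Ι 0F ⊕ Ι 4F))
      (h (suc n) ∷ f 0 ∷ g 0 ∷ (f ∘ suc *ˢ h) n ∷ (g ∘ suc *ˢ h) n ∷ []) refl)

  ∙-*ˢ : ∀ x f g → (x ∙ f) *ˢ g ≈ˢ x ∙ (f *ˢ g)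
  ∙-*ˢ x f g zero    = *-assoc _ _ _
  ∙-*ˢ x f g (suc n) = ≈-trans
    (+-cong (*-assoc _ _ _) (∙-*ˢ x (f ∘ suc) g n))
    (≈-sym (distribˡ _ _ _))

  -- The mirror image of the defining recursion, splitting off the constant term of the right
  -- factor. Commutativity and `regular-series` both rest on it.
  *ˢ-tailʳ : ∀ f g n → (f *ˢ g) (suc n) ≈ f (suc n) * g 0 + (f *ˢ (g ∘ suc)) n
  *ˢ-tailʳ f g zero    = +-comm _ _
  *ˢ-tailʳ f g (suc n) = ≈-trans
    (+-cong ≈-refl (*ˢ-tailʳ (f ∘ suc) g n))
    (solve (Ι 0F ⊕ (Ι 1F ⊕ Ι 2F)) (Ι 1F ⊕ (Ι 0F ⊕ Ι 2F))
      (f 0 * g (suc (suc n)) ∷ f (suc (suc n)) * g 0 ∷ (f ∘ suc *ˢ g ∘ suc) n ∷ []) refl)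

  *ˢ-comm : ∀ f g → f *ˢ g ≈ˢ g *ˢ f
  *ˢ-comm f g zero    = *-comm _ _
  *ˢ-comm f g (suc n) = ≈-trans
    (+-cong (*-comm _ _) (*ˢ-comm (f ∘ suc) g n))
    (≈-sym (*ˢ-tailʳ g f n))

  *ˢ-assoc : ∀ f g h → (f *ˢ g) *ˢ h ≈ˢ f *ˢ (g *ˢ h)
  *ˢ-assoc f g h zero    = *-assoc _ _ _
  *ˢ-assoc f g h (suc n) = begin
    f 0 * g 0 * h (suc n) + ((f 0 ∙ g ∘ suc +ˢ f ∘ suc *ˢ g) *ˢ h) n
      ≈⟨ +-cong ≈-refl (≈-trans (*ˢ-distribʳ (f 0 ∙ g ∘ suc) (f ∘ suc *ˢ g) h n)
           (+-cong (∙-*ˢ (f 0) (g ∘ suc) h n) (*ˢ-assoc (f ∘ suc) g h n))) ⟩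
    f 0 * g 0 * h (suc n) + (f 0 * (g ∘ suc *ˢ h) n + (f ∘ suc *ˢ (g *ˢ h)) n)
      ≈⟨ solve (Ι 0F ⊗ Ι 1F ⊗ Ι 2F ⊕ (Ι 0F ⊗ Ι 3F ⊕ Ι 4F)) (Ι 0F ⊗ (Ι 1F ⊗ Ι 2F ⊕ Ι 3F) ⊕ Ι 4F)
           (f 0 ∷ g 0 ∷ h (suc n) ∷ (g ∘ suc *ˢ h) n ∷ (f ∘ suc *ˢ (g *ˢ h)) n ∷ []) refl ⟩
    f 0 * (g 0 * h (suc n) + (g ∘ suc *ˢ h) n) + (f ∘ suc *ˢ (g *ˢ h)) n ∎

  *ˢ-zeroˡ : ∀ {f} g → (∀ n → f n ≈ 0#) → ∀ n → (f *ˢ g) n ≈ 0#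
  *ˢ-zeroˡ g f≈0 zero    = ≈-trans (*-cong (f≈0 0) ≈-refl) (zeroˡ _)
  *ˢ-zeroˡ g f≈0 (suc n) = ≈-trans
    (+-cong (≈-trans (*-cong (f≈0 0) ≈-refl) (zeroˡ _)) (*ˢ-zeroˡ g (f≈0 ∘ suc) n))
    (+-identityˡ _)

  const-*ˢ : ∀ x f → const x *ˢ f ≈ˢ x ∙ f
  const-*ˢ x f zero    = ≈-refl
  const-*ˢ x f (suc n) = ≈-trans (+-cong ≈-refl (*ˢ-zeroˡ f (λ _ → ≈-refl) n)) (+-identityʳ _)

  const-cong : ∀ {x y} → x ≈ y → const x ≈ˢ const y
  const-cong p zero    = p
  const-cong p (suc n) = ≈-refl

  const-+ : ∀ x y → const (x + y) ≈ˢ const x +ˢ const y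
  const-+ x y zero    = ≈-refl
  const-+ x y (suc n) = ≈-sym (+-identityˡ _)

  const-* : ∀ x y → const (x * y) ≈ˢ const x *ˢ const y
  const-* x y zero    = ≈-refl
  const-* x y (suc n) = ≈-sym (≈-trans (const-*ˢ x (const y) (suc n)) (zeroʳ _))

  const-neg : ∀ x → const (- x) ≈ˢ -_ ∘ const x
  const-neg x zero    = ≈-refl
  const-neg x (suc n) = ≈-trans (≈-sym (-‿inverseˡ 0#)) (+-identityʳ _)

  seriesRing : ℚ-Algebra
  seriesRing = record
    { commutativeRing = CommutativeRingLaws.commutativeRing {R = record
        { Carrier = Series ; _≈_ = _≈ˢ_ ; _+_ = _+ˢ_ ; _*_ = _*ˢ_ ; -_ = λ f n → - f n
        ; 0# = λ _ → 0# ; 1# = const 1# }} record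
      { isEquivalence = record
        { refl = λ _ → ≈-refl ; sym = λ p n → ≈-sym (p n) ; trans = λ p q n → ≈-trans (p n) (q n) }
      ; +-cong = λ p q n → +-cong (p n) (q n)
      ; *-cong = *ˢ-cong
      ; -‿cong = λ p n → -‿cong (p n)
      ; +-assoc = λ _ _ _ _ → +-assoc _ _ _
      ; +-comm = λ _ _ _ → +-comm _ _
      ; +-identityˡ = λ _ _ → +-identityˡ _
      ; -‿inverseˡ = λ _ _ → -‿inverseˡ _
      ; *-assoc = *ˢ-assoc
      ; *-comm = *ˢ-comm
      ; *-identityˡ = λ f n → ≈-trans (const-*ˢ 1# f n) (*-identityˡ _)
      ; distribˡ = *ˢ-distribˡ
      }
    ; κ   = const ∘ κ
    ; κ-+ = λ r s n → ≈-trans (const-cong (κ-+ r s) n) (const-+ _ _ n)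
    ; κ-* = λ r s n → ≈-trans (const-cong (κ-* r s) n) (const-* _ _ n)
    ; κ-- = λ r n → ≈-trans (const-cong (κ-- r) n) (const-neg _ n)
    ; κ-0 = λ { zero → κ-0 ; (suc n) → ≈-refl }
    ; κ-1 = const-cong κ-1
    }

  private module S = ℚ-Algebra seriesRing

  constantTerm : seriesRing ⟶ K
  constantTerm = record
    { ⟦_⟧ = λ f → f 0 ; cong = λ p → p 0 ; +-homo = λ _ _ → ≈-refl ; *-homo = λ _ _ → ≈-refl
    ; -‿homo = λ _ → ≈-refl ; κ-homo = λ _ → ≈-refl }

  -- If f g = 0, the constant terms force g 0 = 0, so f also annihilates the tail of g; the
  -- recursion passes to that tail and lowers the index.
  regular-series : ∀ f → f 0 Regular → f S.Regular
  regular-series f reg g fg≈0 zero    = reg (g 0) (fg≈0 0)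
  regular-series f reg g fg≈0 (suc n) = regular-series f reg (g ∘ suc) fg′≈0 n
    where
    fg′≈0 : ∀ n → (f *ˢ (g ∘ suc)) n ≈ 0#
    fg′≈0 n = begin
      (f *ˢ (g ∘ suc)) n                    ≈⟨ +-identityˡ _ ⟨
      0# + (f *ˢ (g ∘ suc)) n               ≈⟨ +-cong (≈-trans (*-cong ≈-refl (reg (g 0) (fg≈0 0))) (zeroʳ _)) ≈-refl ⟨
      f (suc n) * g 0 + (f *ˢ (g ∘ suc)) n  ≈⟨ *ˢ-tailʳ f g n ⟨
      (f *ˢ g) (suc n)                      ≈⟨ fg≈0 (suc n) ⟩
      0#                                    ∎

  linear : Carrier → Series
  linear x zero    = x
  linear x (suc n) = const 1# n

  module _ {x x⁻¹ : Carrier} (inverse : x * x⁻¹ ≈ 1#) where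
    -- The geometric series of 1 / (x + t), where t is the variable and `linear x` is x + t.
    linear⁻¹ : Series
    linear⁻¹ zero    = x⁻¹
    linear⁻¹ (suc n) = - (x⁻¹ * linear⁻¹ n)

    linear-inverse : linear x *ˢ linear⁻¹ ≈ˢ const 1#
    linear-inverse zero    = inverse
    linear-inverse (suc n) = begin
      x * - (x⁻¹ * linear⁻¹ n) + (const 1# *ˢ linear⁻¹) n
        ≈⟨ +-cong ≈-refl (const-*ˢ 1# linear⁻¹ n) ⟩
      x * - (x⁻¹ * linear⁻¹ n) + 1# * linear⁻¹ n
        ≈⟨ solve (Ι 0F ⊗ ⊝ (Ι 1F ⊗ Ι 2F) ⊕ Ι 3F ⊗ Ι 2F) ((⊝ (Ι 0F ⊗ Ι 1F) ⊕ Ι 3F) ⊗ Ι 2F)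
             (x ∷ x⁻¹ ∷ linear⁻¹ n ∷ 1# ∷ []) refl ⟩
      (- (x * x⁻¹) + 1#) * linear⁻¹ n
        ≈⟨ *-cong (≈-trans (+-cong (-‿cong inverse) ≈-refl) (-‿inverseˡ _)) ≈-refl ⟩
      0# * linear⁻¹ n
        ≈⟨ zeroˡ _ ⟩
      0# ∎

  module _ {A : ℚ-Algebra} (K⇀A : K ⇀ A) (t : ℚ-Algebra.Carrier A) where
    private module A where
      open ℚ-Algebra A public
      open Solver A public
    open _⇀_ K⇀A

    -- A finite Horner scheme: f has finitely many nonzero coefficients, and p results from putting
    -- t for the variable. An arbitrary series has no value at t in A, hence a relation instead of a
    -- map.
    data _~ˢ_ (f : Series) (p : A.Carrier) : Set where
      nil  : (∀ n → f n ≈ 0#) → p A.≈ A.0# → f ~ˢ p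
      cons : ∀ {p₀ p′} → f 0 ~ p₀ → (f ∘ suc) ~ˢ p′ → p A.≈ p₀ A.+ t A.* p′ → f ~ˢ p

    ~ˢ-resp : ∀ {f f′ p p′} → f ≈ˢ f′ → p A.≈ p′ → f ~ˢ p → f′ ~ˢ p′
    ~ˢ-resp f≈ p≈ (nil f≈0 p≈0)  = nil (λ n → ≈-trans (≈-sym (f≈ n)) (f≈0 n)) (A.≈-trans (A.≈-sym p≈) p≈0)
    ~ˢ-resp f≈ p≈ (cons f₀ f′ eq) = cons (~-resp (f≈ 0) A.≈-refl f₀) (~ˢ-resp (f≈ ∘ suc) A.≈-refl f′)
                                      (A.≈-trans (A.≈-sym p≈) eq)

    ~ˢ-+ : ∀ {f g p q} → f ~ˢ p → g ~ˢ q → (f +ˢ g) ~ˢ (p A.+ q)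
    ~ˢ-+ (nil f≈0 p≈0) g~ = ~ˢ-resp
      (λ n → ≈-sym (≈-trans (+-cong (f≈0 n) ≈-refl) (+-identityˡ _)))
      (A.≈-sym (A.≈-trans (A.+-cong p≈0 A.≈-refl) (A.+-identityˡ _))) g~
    ~ˢ-+ f~@(cons _ _ _) (nil g≈0 q≈0) = ~ˢ-resp
      (λ n → ≈-sym (≈-trans (+-cong ≈-refl (g≈0 n)) (+-identityʳ _)))
      (A.≈-sym (A.≈-trans (A.+-cong A.≈-refl q≈0) (A.+-identityʳ _))) f~
    ~ˢ-+ (cons {p₀} {p′} f₀ f′ p≈) (cons {q₀} {q′} g₀ g′ q≈) = cons (~-+ f₀ g₀) (~ˢ-+ f′ g′)
      (A.≈-trans (A.+-cong p≈ q≈)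
        (A.solve ((Ι 0F ⊕ Ι 4F ⊗ Ι 1F) ⊕ (Ι 2F ⊕ Ι 4F ⊗ Ι 3F)) ((Ι 0F ⊕ Ι 2F) ⊕ Ι 4F ⊗ (Ι 1F ⊕ Ι 3F))
          (p₀ ∷ p′ ∷ q₀ ∷ q′ ∷ t ∷ []) refl))

    ~ˢ-neg : ∀ {f p} → f ~ˢ p → (λ n → - f n) ~ˢ (A.- p)
    ~ˢ-neg (nil f≈0 p≈0) = nil
      (λ n → ≈-trans (-‿cong (f≈0 n)) (≈-sym (const-neg 0# 1)))
      (A.≈-trans (A.-‿cong p≈0)
        (A.≈-trans (A.≈-sym (A.≈-trans (A.κ-- 0ℚ) (A.-‿cong A.κ-0))) A.κ-0))
    ~ˢ-neg (cons {p₀} {p′} f₀ f′ p≈) = cons (~-neg f₀) (~ˢ-neg f′)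
      (A.≈-trans (A.-‿cong p≈)
        (A.solve (⊝ (Ι 0F ⊕ Ι 2F ⊗ Ι 1F)) (⊝ (Ι 0F) ⊕ Ι 2F ⊗ ⊝ (Ι 1F)) (p₀ ∷ p′ ∷ t ∷ []) refl))

    ~ˢ-∙ : ∀ {x f p q} → x ~ p → f ~ˢ q → (x ∙ f) ~ˢ (p A.* q)
    ~ˢ-∙ x~ (nil f≈0 q≈0) = nil
      (λ n → ≈-trans (*-cong ≈-refl (f≈0 n)) (zeroʳ _))
      (A.≈-trans (A.*-cong A.≈-refl q≈0) (A.zeroʳ _))
    ~ˢ-∙ {p = p} x~ (cons {q₀} {q′} f₀ f′ q≈) = cons (~-* x~ f₀) (~ˢ-∙ x~ f′)
      (A.≈-trans (A.*-cong A.≈-refl q≈)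
        (A.solve (Ι 0F ⊗ (Ι 1F ⊕ Ι 3F ⊗ Ι 2F)) (Ι 0F ⊗ Ι 1F ⊕ Ι 3F ⊗ (Ι 0F ⊗ Ι 2F)) (p ∷ q₀ ∷ q′ ∷ t ∷ []) refl))

    ~ˢ-const : ∀ {x p} → x ~ p → const x ~ˢ p
    ~ˢ-const x~p = cons x~p (nil (λ _ → ≈-refl) A.≈-refl)
      (A.≈-sym (A.≈-trans (A.+-cong A.≈-refl (A.zeroʳ _)) (A.+-identityʳ _)))

    ~ˢ-shift : ∀ {f p} → f ~ˢ p → shift f ~ˢ (t A.* p)
    ~ˢ-shift f~p = cons ~-0 f~p (A.≈-sym (A.+-identityˡ _))

    ~ˢ-* : ∀ {f g p q} → f ~ˢ p → g ~ˢ q → (f *ˢ g) ~ˢ (p A.* q)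
    ~ˢ-* {g = g} (nil f≈0 p≈0) g~ = nil (*ˢ-zeroˡ g f≈0)
      (A.≈-trans (A.*-cong p≈0 A.≈-refl) (A.zeroˡ _))
    ~ˢ-* {f} {g} {q = q} (cons {p₀} {p′} f₀ f′ p≈) g~ = ~ˢ-resp
      (λ { zero → +-identityʳ _ ; (suc n) → ≈-refl })
      (A.≈-trans
        (A.solve (Ι 0F ⊗ Ι 1F ⊕ Ι 2F ⊗ (Ι 3F ⊗ Ι 1F)) ((Ι 0F ⊕ Ι 2F ⊗ Ι 3F) ⊗ Ι 1F) (p₀ ∷ q ∷ t ∷ p′ ∷ []) refl)
        (A.*-cong (A.≈-sym p≈) A.≈-refl))
      (~ˢ-+ (~ˢ-∙ f₀ g~) (~ˢ-shift (~ˢ-* f′ g~)))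

    ~ˢ-linear : ∀ {x p} → x ~ p → linear x ~ˢ (p A.+ t)
    ~ˢ-linear x~p = cons x~p (~ˢ-const ~-1)
      (A.+-cong A.≈-refl (A.≈-sym (A.*-identityʳ _)))

    -- The scheme of a zero series may still have many steps; each of its coefficients is zero by
    -- `~-zero` one level down, and p collapses from the inside out.
    ~ˢ-zero : ∀ {f p} → f ~ˢ p → f ≈ˢ (λ _ → 0#) → p A.≈ A.0#
    ~ˢ-zero (nil _ p≈0)     f≈0 = p≈0
    ~ˢ-zero (cons f₀ f′ p≈) f≈0 = A.≈-trans p≈ (A.≈-trans
      (A.+-cong (~-zero f₀ (f≈0 0)) (A.≈-trans (A.*-cong A.≈-refl (~ˢ-zero f′ (f≈0 ∘ suc))) (A.zeroʳ _)))
      (A.+-identityˡ _))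

    evaluateAt : seriesRing ⇀ A
    evaluateAt = record
      { _~_ = _~ˢ_ ; ~-resp = ~ˢ-resp ; ~-+ = ~ˢ-+ ; ~-* = ~ˢ-* ; ~-neg = ~ˢ-neg
      ; ~-κ = λ r → ~ˢ-const (~-κ r) ; ~-zero = ~ˢ-zero }

-- Adjoining a square root

module QuadraticExtension (K : ℚ-Algebra) (m : ℚ-Algebra.Carrier K) where
  open ℚ-Algebra K
  open Solver K

  infix  4 _≈²_
  infixl 7 _*²_

  _≈²_ : Carrier × Carrier → Carrier × Carrier → Set
  (x , y) ≈² (x′ , y′) = x ≈ x′ × y ≈ y′

  _*²_ : Carrier × Carrier → Carrier × Carrier → Carrier × Carrier
  (x , y) *² (z , w) = x * z + m * (y * w) , x * w + y * z

  extension : ℚ-Algebra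
  extension = record
    { commutativeRing = CommutativeRingLaws.commutativeRing {R = record
        { Carrier = Carrier × Carrier ; _≈_ = _≈²_
        ; _+_ = λ { (x , y) (z , w) → x + z , y + w } ; _*_ = _*²_
        ; -_ = λ { (x , y) → - x , - y } ; 0# = 0# , 0# ; 1# = 1# , 0# }} record
      { isEquivalence = record
        { refl  = ≈-refl , ≈-refl
        ; sym   = λ { (p , q) → ≈-sym p , ≈-sym q }
        ; trans = λ { (p , q) (p′ , q′) → ≈-trans p p′ , ≈-trans q q′ } }
      ; +-cong = λ { (p , q) (p′ , q′) → +-cong p p′ , +-cong q q′ }
      ; *-cong = λ { (p , q) (p′ , q′) →
          +-cong (*-cong p p′) (*-cong ≈-refl (*-cong q q′)) , +-cong (*-cong p q′) (*-cong q p′) }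
      ; -‿cong = λ { (p , q) → -‿cong p , -‿cong q }
      ; +-assoc = λ _ _ _ → +-assoc _ _ _ , +-assoc _ _ _
      ; +-comm = λ _ _ → +-comm _ _ , +-comm _ _
      ; +-identityˡ = λ _ → +-identityˡ _ , +-identityˡ _
      ; -‿inverseˡ = λ _ → -‿inverseˡ _ , -‿inverseˡ _
      ; *-assoc = λ { (x , y) (z , w) (s , t) → let ρ = x ∷ y ∷ z ∷ w ∷ s ∷ t ∷ m ∷ [] in
            solve ((Ι 0F ⊗ Ι 2F ⊕ Ι 6F ⊗ (Ι 1F ⊗ Ι 3F)) ⊗ Ι 4F ⊕ Ι 6F ⊗ ((Ι 0F ⊗ Ι 3F ⊕ Ι 1F ⊗ Ι 2F) ⊗ Ι 5F))
              (Ι 0F ⊗ (Ι 2F ⊗ Ι 4F ⊕ Ι 6F ⊗ (Ι 3F ⊗ Ι 5F)) ⊕ Ι 6F ⊗ (Ι 1F ⊗ (Ι 2F ⊗ Ι 5F ⊕ Ι 3F ⊗ Ι 4F))) ρ refl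
          , solve ((Ι 0F ⊗ Ι 2F ⊕ Ι 6F ⊗ (Ι 1F ⊗ Ι 3F)) ⊗ Ι 5F ⊕ (Ι 0F ⊗ Ι 3F ⊕ Ι 1F ⊗ Ι 2F) ⊗ Ι 4F)
              (Ι 0F ⊗ (Ι 2F ⊗ Ι 5F ⊕ Ι 3F ⊗ Ι 4F) ⊕ Ι 1F ⊗ (Ι 2F ⊗ Ι 4F ⊕ Ι 6F ⊗ (Ι 3F ⊗ Ι 5F))) ρ refl }
      ; *-comm = λ { (x , y) (z , w) → let ρ = x ∷ y ∷ z ∷ w ∷ m ∷ [] in
            solve (Ι 0F ⊗ Ι 2F ⊕ Ι 4F ⊗ (Ι 1F ⊗ Ι 3F)) (Ι 2F ⊗ Ι 0F ⊕ Ι 4F ⊗ (Ι 3F ⊗ Ι 1F)) ρ refl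
          , solve (Ι 0F ⊗ Ι 3F ⊕ Ι 1F ⊗ Ι 2F) (Ι 2F ⊗ Ι 1F ⊕ Ι 3F ⊗ Ι 0F) ρ refl }
      ; *-identityˡ = λ _ →
            ≈-trans (+-cong (*-identityˡ _) (≈-trans (*-cong ≈-refl (zeroˡ _)) (zeroʳ _))) (+-identityʳ _)
          , ≈-trans (+-cong (*-identityˡ _) (zeroˡ _)) (+-identityʳ _)
      ; distribˡ = λ { (x , y) (z , w) (s , t) → let ρ = x ∷ y ∷ z ∷ w ∷ s ∷ t ∷ m ∷ [] in
            solve (Ι 0F ⊗ (Ι 2F ⊕ Ι 4F) ⊕ Ι 6F ⊗ (Ι 1F ⊗ (Ι 3F ⊕ Ι 5F)))
              ((Ι 0F ⊗ Ι 2F ⊕ Ι 6F ⊗ (Ι 1F ⊗ Ι 3F)) ⊕ (Ι 0F ⊗ Ι 4F ⊕ Ι 6F ⊗ (Ι 1F ⊗ Ι 5F))) ρ refl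
          , solve (Ι 0F ⊗ (Ι 3F ⊕ Ι 5F) ⊕ Ι 1F ⊗ (Ι 2F ⊕ Ι 4F))
              ((Ι 0F ⊗ Ι 3F ⊕ Ι 1F ⊗ Ι 2F) ⊕ (Ι 0F ⊗ Ι 5F ⊕ Ι 1F ⊗ Ι 4F)) ρ refl }
      }
    ; κ   = λ r → κ r , 0#
    ; κ-+ = λ r s → κ-+ r s , ≈-sym (+-identityˡ _)
    ; κ-* = λ r s → base-* (κ-* r s)
    ; κ-- = λ r → κ-- r , ≈-sym 0≈-0
    ; κ-0 = κ-0 , ≈-refl
    ; κ-1 = κ-1 , ≈-refl
    }
    where
    0≈-0 : - 0# ≈ 0#
    0≈-0 = ≈-trans (≈-sym (+-identityʳ _)) (-‿inverseˡ 0#)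
    base-* : ∀ {x y z} → z ≈ x * y → (z , 0#) ≈² (x , 0#) *² (y , 0#)
    base-* p = ≈-sym (≈-trans (+-cong (≈-sym p) (≈-trans (*-cong ≈-refl (zeroˡ _)) (zeroʳ _))) (+-identityʳ _))
             , ≈-sym (≈-trans (+-cong (zeroʳ _) (zeroˡ _)) (+-identityˡ _))

  private module E = ℚ-Algebra extension

  inclusion : K ⟶ extension
  inclusion = record
    { ⟦_⟧ = λ x → x , 0#
    ; cong = λ p → p , ≈-refl
    ; +-homo = λ _ _ → ≈-refl , ≈-sym (+-identityˡ _)
    ; *-homo = λ _ _ →
        ≈-sym (≈-trans (+-cong ≈-refl (≈-trans (*-cong ≈-refl (zeroˡ _)) (zeroʳ _))) (+-identityʳ _))
      , ≈-sym (≈-trans (+-cong (zeroʳ _) (zeroˡ _)) (+-identityˡ _))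
    ; -‿homo = λ _ → ≈-refl , ≈-trans (≈-sym (-‿inverseˡ 0#)) (+-identityʳ _)
    ; κ-homo = λ _ → E.≈-refl
    }

  root : E.Carrier
  root = 0# , 1#

  root² : root E.* root E.≈ _⟶_.⟦ inclusion ⟧ m
  root² = ≈-trans (+-cong (zeroˡ _) (≈-trans (*-cong ≈-refl (*-identityˡ _)) (*-identityʳ _))) (+-identityˡ _)
        , ≈-trans (+-cong (zeroˡ _) (zeroʳ _)) (+-identityˡ _)

  -- Multiplication by the conjugate (x , - y) turns the two component equations into norm · z = 0
  -- and norm · w = 0.
  regular-norm : ∀ x y → (x * x - m * (y * y)) Regular → (x , y) E.Regular
  regular-norm x y reg (z , w) (xz+myw≈0 , xw+yz≈0) =
    let ρ = x ∷ y ∷ z ∷ w ∷ m ∷ [] in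
      reg z (≈-trans
        (solve ((Ι 0F ⊗ Ι 0F ⊕ ⊝ (Ι 4F ⊗ (Ι 1F ⊗ Ι 1F))) ⊗ Ι 2F)
          (Ι 0F ⊗ (Ι 0F ⊗ Ι 2F ⊕ Ι 4F ⊗ (Ι 1F ⊗ Ι 3F)) ⊕ ⊝ (Ι 4F ⊗ Ι 1F) ⊗ (Ι 0F ⊗ Ι 3F ⊕ Ι 1F ⊗ Ι 2F)) ρ refl)
        (combination xz+myw≈0 xw+yz≈0))
    , reg w (≈-trans
        (solve ((Ι 0F ⊗ Ι 0F ⊕ ⊝ (Ι 4F ⊗ (Ι 1F ⊗ Ι 1F))) ⊗ Ι 3F)
          (Ι 0F ⊗ (Ι 0F ⊗ Ι 3F ⊕ Ι 1F ⊗ Ι 2F) ⊕ ⊝ (Ι 1F) ⊗ (Ι 0F ⊗ Ι 2F ⊕ Ι 4F ⊗ (Ι 1F ⊗ Ι 3F))) ρ refl)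
        (combination xw+yz≈0 xz+myw≈0))
    where
    combination : ∀ {p q r s} → p ≈ 0# → q ≈ 0# → r * p + s * q ≈ 0#
    combination p≈0 q≈0 = ≈-trans
      (+-cong (≈-trans (*-cong ≈-refl p≈0) (zeroʳ _)) (≈-trans (*-cong ≈-refl q≈0) (zeroʳ _)))
      (+-identityˡ _)

  module _ {L : ℚ-Algebra} (h : K ⟶ L) (r : ℚ-Algebra.Carrier L) where
    private
      module L where
        open ℚ-Algebra L public
        open Solver L public
      module h = _⟶_ h

    module _ (r² : r L.* r L.≈ h.⟦ m ⟧) where
      private
        f : E.Carrier → L.Carrier
        f (x , y) = h.⟦ x ⟧ L.+ h.⟦ y ⟧ L.* r

      extend : extension ⟶ L
      extend = record
        { ⟦_⟧ = f
        ; cong = λ { (p , q) → L.+-cong (h.cong p) (L.*-cong (h.cong q) L.≈-refl) }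
        ; +-homo = λ { (x , y) (z , w) → L.≈-trans
            (L.+-cong (h.+-homo x z) (L.*-cong (h.+-homo y w) L.≈-refl))
            (L.solve ((Ι 0F ⊕ Ι 2F) ⊕ (Ι 1F ⊕ Ι 3F) ⊗ Ι 4F) ((Ι 0F ⊕ Ι 1F ⊗ Ι 4F) ⊕ (Ι 2F ⊕ Ι 3F ⊗ Ι 4F))
              (h.⟦ x ⟧ ∷ h.⟦ y ⟧ ∷ h.⟦ z ⟧ ∷ h.⟦ w ⟧ ∷ r ∷ []) refl) }
        ; *-homo = λ { (x , y) (z , w) → L.≈-trans
            (L.+-cong
              (L.≈-trans (h.+-homo _ _) (L.+-cong (h.*-homo x z)
                (L.≈-trans (h.*-homo m _) (L.*-cong (L.≈-sym r²) (h.*-homo y w)))))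
              (L.*-cong (L.≈-trans (h.+-homo _ _) (L.+-cong (h.*-homo x w) (h.*-homo y z))) L.≈-refl))
            (L.solve ((Ι 0F ⊗ Ι 2F ⊕ (Ι 4F ⊗ Ι 4F) ⊗ (Ι 1F ⊗ Ι 3F)) ⊕ (Ι 0F ⊗ Ι 3F ⊕ Ι 1F ⊗ Ι 2F) ⊗ Ι 4F)
              ((Ι 0F ⊕ Ι 1F ⊗ Ι 4F) ⊗ (Ι 2F ⊕ Ι 3F ⊗ Ι 4F))
              (h.⟦ x ⟧ ∷ h.⟦ y ⟧ ∷ h.⟦ z ⟧ ∷ h.⟦ w ⟧ ∷ r ∷ []) refl) }
        ; -‿homo = λ { (x , y) → L.≈-trans
            (L.+-cong (h.-‿homo x) (L.*-cong (h.-‿homo y) L.≈-refl))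
            (L.solve (⊝ (Ι 0F) ⊕ ⊝ (Ι 1F) ⊗ Ι 2F) (⊝ (Ι 0F ⊕ Ι 1F ⊗ Ι 2F)) (h.⟦ x ⟧ ∷ h.⟦ y ⟧ ∷ r ∷ []) refl) }
        ; κ-homo = λ s → L.≈-trans
            (L.+-cong (h.κ-homo s) (L.≈-trans (L.*-cong h.0-homo L.≈-refl) (L.zeroˡ _)))
            (L.+-identityʳ _)
        }

      extend-inclusion : ∀ x → f (x , 0#) L.≈ h.⟦ x ⟧
      extend-inclusion x = L.≈-trans
        (L.+-cong L.≈-refl (L.≈-trans (L.*-cong h.0-homo L.≈-refl) (L.zeroˡ _))) (L.+-identityʳ _)

      extend-root : f root L.≈ r
      extend-root = L.≈-trans
        (L.+-cong h.0-homo (L.≈-trans (L.*-cong h.1-homo L.≈-refl) (L.*-identityˡ _))) (L.+-identityˡ _)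

      -- The norm becomes the product of the values for the two roots r and - r. Two signs at each
      -- of two extensions account for the four evaluation points.
      extend-norm : ∀ x y → h.⟦ x * x - m * (y * y) ⟧ L.≈
                    (h.⟦ x ⟧ L.+ h.⟦ y ⟧ L.* r) L.* (h.⟦ x ⟧ L.+ h.⟦ y ⟧ L.* (L.- r))
      extend-norm x y = L.≈-trans
        (L.≈-trans (h.+-homo _ _) (L.+-cong (h.*-homo x x)
          (L.≈-trans (h.-‿homo _) (L.-‿cong
            (L.≈-trans (h.*-homo m _) (L.*-cong (L.≈-sym r²) (h.*-homo y y)))))))
        (L.solve (Ι 0F ⊗ Ι 0F ⊕ ⊝ ((Ι 2F ⊗ Ι 2F) ⊗ (Ι 1F ⊗ Ι 1F))) ((Ι 0F ⊕ Ι 1F ⊗ Ι 2F) ⊗ (Ι 0F ⊕ Ι 1F ⊗ ⊝ (Ι 2F)))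
          (h.⟦ x ⟧ ∷ h.⟦ y ⟧ ∷ r ∷ []) refl)

  module _ {A : ℚ-Algebra} (K⇀A : K ⇀ A) (t : ℚ-Algebra.Carrier A) where
    private module A where
      open ℚ-Algebra A public
      open Solver A public
    open _⇀_ K⇀A

    module _ (t² : m ~ t A.* t) where
      private
        _~²_ : E.Carrier → A.Carrier → Set
        (x , y) ~² p = ∃[ p₁ ] ∃[ p₂ ] x ~ p₁ × y ~ p₂ × p A.≈ p₁ A.+ p₂ A.* t

      rootAt : extension ⇀ A
      rootAt = record
        { _~_ = _~²_
        ; ~-resp = λ { (x≈ , y≈) p≈ (_ , _ , x~ , y~ , eq) →
            _ , _ , ~-resp x≈ A.≈-refl x~ , ~-resp y≈ A.≈-refl y~ , A.≈-trans (A.≈-sym p≈) eq }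
        ; ~-+ = λ { (p₁ , p₂ , x~ , y~ , p≈) (q₁ , q₂ , z~ , w~ , q≈) →
            _ , _ , ~-+ x~ z~ , ~-+ y~ w~ , A.≈-trans (A.+-cong p≈ q≈)
              (A.solve ((Ι 0F ⊕ Ι 1F ⊗ Ι 4F) ⊕ (Ι 2F ⊕ Ι 3F ⊗ Ι 4F)) ((Ι 0F ⊕ Ι 2F) ⊕ (Ι 1F ⊕ Ι 3F) ⊗ Ι 4F)
                (p₁ ∷ p₂ ∷ q₁ ∷ q₂ ∷ t ∷ []) refl) }
        ; ~-* = λ { (p₁ , p₂ , x~ , y~ , p≈) (q₁ , q₂ , z~ , w~ , q≈) →
            _ , _ , ~-+ (~-* x~ z~) (~-* t² (~-* y~ w~)) , ~-+ (~-* x~ w~) (~-* y~ z~)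
            , A.≈-trans (A.*-cong p≈ q≈)
              (A.solve ((Ι 0F ⊕ Ι 1F ⊗ Ι 4F) ⊗ (Ι 2F ⊕ Ι 3F ⊗ Ι 4F))
                ((Ι 0F ⊗ Ι 2F ⊕ (Ι 4F ⊗ Ι 4F) ⊗ (Ι 1F ⊗ Ι 3F)) ⊕ (Ι 0F ⊗ Ι 3F ⊕ Ι 1F ⊗ Ι 2F) ⊗ Ι 4F)
                (p₁ ∷ p₂ ∷ q₁ ∷ q₂ ∷ t ∷ []) refl) }
        ; ~-neg = λ { (p₁ , p₂ , x~ , y~ , p≈) →
            _ , _ , ~-neg x~ , ~-neg y~ , A.≈-trans (A.-‿cong p≈)
              (A.solve (⊝ (Ι 0F ⊕ Ι 1F ⊗ Ι 2F)) (⊝ (Ι 0F) ⊕ ⊝ (Ι 1F) ⊗ Ι 2F) (p₁ ∷ p₂ ∷ t ∷ []) refl) }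
        ; ~-κ = λ r → _ , _ , ~-κ r , ~-0 , A.≈-sym (p+0t≈p _)
        ; ~-zero = λ { (p₁ , p₂ , x~ , y~ , p≈) (x≈0 , y≈0) → A.≈-trans p≈
            (A.≈-trans (A.+-cong (~-zero x~ x≈0) (A.≈-trans (A.*-cong (~-zero y~ y≈0) A.≈-refl) (A.zeroˡ _)))
              (A.+-identityˡ _)) }
        }
        where
        p+0t≈p : ∀ p → p A.+ A.0# A.* t A.≈ p
        p+0t≈p p = A.≈-trans (A.+-cong A.≈-refl (A.zeroˡ t)) (A.+-identityʳ p)

      ~-inclusion : ∀ {x p} → x ~ p → _⇀_._~_ rootAt (x , 0#) p
      ~-inclusion x~p = _ , _ , x~p , ~-0 ,
        A.≈-sym (A.≈-trans (A.+-cong A.≈-refl (A.zeroˡ t)) (A.+-identityʳ _))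

      ~-root : _⇀_._~_ rootAt root t
      ~-root = _ , _ , ~-0 , ~-1 , A.≈-sym (A.≈-trans (A.+-identityˡ _) (A.*-identityˡ t))

-- The coordinate ring of X₄ and its embedding

coordinateRing : ℚ-Algebra
coordinateRing = record
  { commutativeRing = CommutativeRingLaws.commutativeRing {R = record
      { Carrier = Poly ; _≈_ = Defs._≈_ ; _+_ = _⊕_ ; _*_ = _⊗_ ; -_ = ⊝_
      ; 0# = Defs.0ᵖ ; 1# = Defs.1ᵖ }} record
    { isEquivalence = record { refl = Defs.≈-refl ; sym = Defs.≈-sym ; trans = Defs.≈-trans }
    ; +-cong = Defs.+-cong ; *-cong = Defs.*-cong ; -‿cong = Defs.-‿cong
    ; +-assoc = Defs.+-assoc ; +-comm = Defs.+-comm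
    ; +-identityˡ = Defs.+-identityˡ ; -‿inverseˡ = Defs.-‿inverseˡ
    ; *-assoc = Defs.*-assoc ; *-comm = Defs.*-comm
    ; *-identityˡ = Defs.*-identityˡ ; distribˡ = Defs.distribˡ }
  ; κ   = Κ
  ; κ-+ = Defs.Κ-+
  ; κ-* = Defs.Κ-*
  ; κ-- = λ r → Defs.≈-trans (Defs.≈-sym (+-identityʳ (Κ (ℚ.- r))))
      (Defs.≈-trans (Defs.+-cong Defs.≈-refl (Defs.≈-sym (inverseʳ (Κ r))))
      (Defs.≈-trans (Defs.≈-sym (Defs.+-assoc _ _ _))
      (Defs.≈-trans (Defs.+-cong (Defs.≈-trans (Defs.≈-sym (Defs.Κ-+ _ _)) (≡⇒≈ (ℚ.+-inverseˡ r))) Defs.≈-refl)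
        (Defs.+-identityˡ _))))
  ; κ-0 = Defs.≈-refl
  ; κ-1 = Defs.≈-refl
  }
  where
  +-identityʳ : ∀ p → p ⊕ Defs.0ᵖ Defs.≈ p
  +-identityʳ p = Defs.≈-trans (Defs.+-comm _ _) (Defs.+-identityˡ p)
  inverseʳ : ∀ p → p ⊕ (⊝ p) Defs.≈ Defs.0ᵖ
  inverseʳ p = Defs.≈-trans (Defs.+-comm _ _) (Defs.-‿inverseˡ p)
  ≡⇒≈ : ∀ {r s} → r ≡ s → Κ r Defs.≈ Κ s
  ≡⇒≈ refl = Defs.≈-refl

private module ℚ[X₄] where
  open ℚ-Algebra coordinateRing public
  open Solver coordinateRing public

coordinates : Vec Poly 4
coordinates = Defs.a ∷ Defs.b ∷ Defs.c ∷ Defs.d ∷ []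

-- Powers are the only real case: evaluation unfolds them into products with the new factor on the
-- right, whereas in `Poly` a power is a constructor governed by `^-zero` and `^-suc`.
eval-coordinates : ∀ p → ℚ[X₄].⟦ p ⟧ coordinates ℚ[X₄].≈ p
eval-coordinates (Κ r)   = ℚ[X₄].≈-refl
eval-coordinates (Ι 0F)  = ℚ[X₄].≈-refl
eval-coordinates (Ι 1F)  = ℚ[X₄].≈-refl
eval-coordinates (Ι 2F)  = ℚ[X₄].≈-refl
eval-coordinates (Ι 3F)  = ℚ[X₄].≈-refl
eval-coordinates (p ⊕ q) = ℚ[X₄].+-cong (eval-coordinates p) (eval-coordinates q)
eval-coordinates (p ⊗ q) = ℚ[X₄].*-cong (eval-coordinates p) (eval-coordinates q)
eval-coordinates (⊝ p)   = ℚ[X₄].-‿cong (eval-coordinates p)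
eval-coordinates (p ⊛ 0) = ℚ[X₄].≈-sym (Defs.^-zero p)
eval-coordinates (p ⊛ 1) = ℚ[X₄].≈-sym (ℚ[X₄].≈-trans (Defs.^-suc p 0)
  (ℚ[X₄].≈-trans (ℚ[X₄].*-cong (ℚ[X₄].≈-sym (eval-coordinates p)) (Defs.^-zero p)) (ℚ[X₄].*-identityʳ _)))
eval-coordinates (p ⊛ suc (suc n)) = ℚ[X₄].≈-sym (ℚ[X₄].≈-trans (Defs.^-suc p (suc n))
  (ℚ[X₄].≈-trans (ℚ[X₄].*-cong (ℚ[X₄].≈-sym (eval-coordinates p)) (ℚ[X₄].≈-sym (eval-coordinates (p ⊛ suc n))))
    (ℚ[X₄].*-comm _ _)))

-- In the variables (b , c): the equations of X₄ solved for a² and d², which exhibits X₄ as a tower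
-- of two double covers of the plane.
a²-formula d²-formula : Expr ℚ 2
a²-formula = nat 2 ⊗ (Ι 0F ⊗ Ι 0F) ⊕ ⊝ (Ι 1F ⊗ Ι 1F) ⊕ nat 2
d²-formula = nat 2 ⊗ (Ι 1F ⊗ Ι 1F) ⊕ ⊝ (Ι 0F ⊗ Ι 0F) ⊕ nat 2

module _ (B : ℚ-Algebra) where
  open ℚ-Algebra B
  open Solver B

  OnX₄ : Vec Carrier 4 → Set
  OnX₄ ρ = ⟦ (Defs.d ⊛ 2) Defs.- 2 Defs.· (Defs.c ⊛ 2) ⊕ (Defs.b ⊛ 2) ⟧ ρ ≈ ⟦ 2 Defs.· Defs.1ᵖ ⟧ ρ
         × ⟦ (Defs.c ⊛ 2) Defs.- 2 Defs.· (Defs.b ⊛ 2) ⊕ (Defs.a ⊛ 2) ⟧ ρ ≈ ⟦ 2 Defs.· Defs.1ᵖ ⟧ ρ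

  -- The universal property of ℚ[X₄], by induction on the derivation of the equality.
  eval-sound : ∀ {ρ} → OnX₄ ρ → ∀ {p q} → p Defs.≈ q → ⟦ p ⟧ ρ ≈ ⟦ q ⟧ ρ
  eval-sound {ρ} (eq₁ , eq₂) = sound
    where
    sound : ∀ {p q} → p Defs.≈ q → ⟦ p ⟧ ρ ≈ ⟦ q ⟧ ρ
    sound Defs.≈-refl = ≈-refl
    sound (Defs.≈-sym e) = ≈-sym (sound e)
    sound (Defs.≈-trans e f) = ≈-trans (sound e) (sound f)
    sound (Defs.+-cong e f) = +-cong (sound e) (sound f)
    sound (Defs.*-cong e f) = *-cong (sound e) (sound f)
    sound (Defs.-‿cong e) = -‿cong (sound e)
    sound (Defs.+-assoc p q r) = +-assoc _ _ _
    sound (Defs.+-comm p q) = +-comm _ _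
    sound (Defs.+-identityˡ p) = ≈-trans (+-cong κ-0 ≈-refl) (+-identityˡ _)
    sound (Defs.-‿inverseˡ p) = ≈-trans (-‿inverseˡ _) (≈-sym κ-0)
    sound (Defs.*-assoc p q r) = *-assoc _ _ _
    sound (Defs.*-comm p q) = *-comm _ _
    sound (Defs.*-identityˡ p) = ≈-trans (*-cong κ-1 ≈-refl) (*-identityˡ _)
    sound (Defs.distribˡ p q r) = distribˡ _ _ _
    sound (Defs.^-zero p) = ≈-sym κ-1
    sound (Defs.^-suc p zero) = ≈-sym (*-identityʳ _)
    sound (Defs.^-suc p (suc n)) = *-comm _ _
    sound (Defs.Κ-+ r s) = κ-+ r s
    sound (Defs.Κ-* r s) = κ-* r s
    sound Defs.X₄-eq₁ = eq₁
    sound Defs.X₄-eq₂ = eq₂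

  onX₄ : ∀ {a b c d} → a * a ≈ ⟦ a²-formula ⟧ (b ∷ c ∷ []) → d * d ≈ ⟦ d²-formula ⟧ (b ∷ c ∷ []) →
         OnX₄ (a ∷ b ∷ c ∷ d ∷ [])
  onX₄ {a} {b} {c} {d} a² d² =
      ≈-trans (+-cong (+-cong d² ≈-refl) ≈-refl)
        (solve (d²-formula ⊕ ⊝ (nat 2 ⊗ (Ι 1F ⊗ Ι 1F)) ⊕ Ι 0F ⊗ Ι 0F) (nat 2 ⊗ Κ 1ℚ) (b ∷ c ∷ []) refl)
    , ≈-trans (+-cong ≈-refl a²)
        (solve (Ι 1F ⊗ Ι 1F ⊕ ⊝ (nat 2 ⊗ (Ι 0F ⊗ Ι 0F)) ⊕ a²-formula) (nat 2 ⊗ Κ 1ℚ) (b ∷ c ∷ []) refl)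

  squares-onX₄ : ∀ {a b c d} → OnX₄ (a ∷ b ∷ c ∷ d ∷ []) →
                 ⟦ a²-formula ⟧ (b ∷ c ∷ []) ≈ a * a × ⟦ d²-formula ⟧ (b ∷ c ∷ []) ≈ d * d
  squares-onX₄ {a} {b} {c} {d} (eq₁ , eq₂) =
      ≈-trans (solve (nat 2 ⊗ (Ι 1F ⊗ Ι 1F) ⊕ ⊝ (Ι 2F ⊗ Ι 2F) ⊕ nat 2)
                 (Ι 0F ⊗ Ι 0F ⊕ ⊝ (Ι 2F ⊗ Ι 2F ⊕ ⊝ (nat 2 ⊗ (Ι 1F ⊗ Ι 1F)) ⊕ Ι 0F ⊗ Ι 0F) ⊕ nat 2 ⊗ Κ 1ℚ) ρ refl)
        (cancel eq₂)
    , ≈-trans (solve (nat 2 ⊗ (Ι 2F ⊗ Ι 2F) ⊕ ⊝ (Ι 1F ⊗ Ι 1F) ⊕ nat 2)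
                 (Ι 3F ⊗ Ι 3F ⊕ ⊝ (Ι 3F ⊗ Ι 3F ⊕ ⊝ (nat 2 ⊗ (Ι 2F ⊗ Ι 2F)) ⊕ Ι 1F ⊗ Ι 1F) ⊕ nat 2 ⊗ Κ 1ℚ) ρ refl)
        (cancel eq₁)
    where
    ρ : Vec Carrier 4
    ρ = a ∷ b ∷ c ∷ d ∷ []
    cancel : ∀ {x y z} → y ≈ z → x + - y + z ≈ x
    cancel {x} {y} {z} y≈z = ≈-trans (+-assoc _ _ _)
      (≈-trans (+-cong ≈-refl (≈-trans (+-cong (-‿cong y≈z) ≈-refl) (-‿inverseˡ z))) (+-identityʳ x))

coordinates-onX₄ : OnX₄ coordinateRing coordinates
coordinates-onX₄ = lift Defs.X₄-eq₁ , lift Defs.X₄-eq₂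
  where
  lift : ∀ {p q} → p Defs.≈ q → ℚ[X₄].⟦ p ⟧ coordinates ℚ[X₄].≈ ℚ[X₄].⟦ q ⟧ coordinates
  lift {p} {q} e = ℚ[X₄].≈-trans (eval-coordinates p) (ℚ[X₄].≈-trans e (ℚ[X₄].≈-sym (eval-coordinates q)))

ℚ-regular : ∀ {r} → r ≢ 0ℚ → ℚ-Algebra._Regular ℚ-algebra r
ℚ-regular {r} r≢0 s rs≡0 = begin
  s                       ≡⟨ ℚ.*-identityˡ s ⟨
  1ℚ ℚ.* s                ≡⟨ ≡.cong (ℚ._* s) (ℚ.*-inverseˡ r) ⟨
  ℚ.1/ r ℚ.* r ℚ.* s      ≡⟨ ℚ.*-assoc (ℚ.1/ r) r s ⟩
  ℚ.1/ r ℚ.* (r ℚ.* s)    ≡⟨ ≡.cong (ℚ.1/ r ℚ.*_) rs≡0 ⟩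
  ℚ.1/ r ℚ.* 0ℚ           ≡⟨ ℚ.*-zeroʳ (ℚ.1/ r) ⟩
  0ℚ                      ∎
  where
  open ≡.≡-Reasoning
  instance _ = ℚ.≢-nonZero r≢0

*-≢0 : ∀ {r s} → r ≢ 0ℚ → s ≢ 0ℚ → r ℚ.* s ≢ 0ℚ
*-≢0 r≢0 s≢0 rs≡0 = s≢0 (ℚ-regular r≢0 _ rs≡0)

-- The local model and its four evaluation points

uᵖ vᵖ : Poly
uᵖ = Defs.c Defs.- Defs.b
vᵖ = Defs.c ⊕ Defs.b

-- A ring containing the polynomial ring in u = c - b and v = b + c, in which u is invertible
-- and elements not vanishing at (u , v) = (½ , 1) are regular.
record Base : Set₁ where
  field
    algebra : ℚ-Algebra
  open ℚ-Algebra algebra public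
  field
    u v u⁻¹    : Carrier
    u-inverse  : u * u⁻¹ ≈ 1#
    evaluation : algebra ⟶ ℚ-algebra
    evaluation-u : _⟶_.⟦_⟧ evaluation u ≡ ½
    evaluation-v : _⟶_.⟦_⟧ evaluation v ≡ 1ℚ
    regular    : ∀ x → _⟶_.⟦_⟧ evaluation x ≢ 0ℚ → x Regular
    graph      : algebra ⇀ coordinateRing
    u~         : _⇀_._~_ graph u uᵖ
    v~         : _⇀_._~_ graph v vᵖ

-- ℚ[[x]][[y]] with u = ½ + x and v = 1 + y. The centre lies off u = 0, so u is a unit; the graph
-- puts u - ½ and v - 1 back for x and y.
powerSeriesBase : Base
powerSeriesBase = record
  { algebra = P₂.seriesRing
  ; u = P₂.const u₁
  ; v = P₂.linear (P₁.const 1ℚ)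
  ; u⁻¹ = P₂.const u₁⁻¹
  ; u-inverse = K.≈-trans {P₂.const u₁ K.* P₂.const u₁⁻¹}
      (K.≈-sym {P₂.const (u₁ P₁.*ˢ u₁⁻¹)} {P₂.const u₁ K.* P₂.const u₁⁻¹} (P₂.const-* u₁ u₁⁻¹))
      (P₂.const-cong (P₁.linear-inverse {½} {rational 2} refl))
  ; evaluation = P₁.constantTerm ∘ʰ P₂.constantTerm
  ; evaluation-u = refl
  ; evaluation-v = refl
  ; regular = λ x x₀₀≢0 → P₂.regular-series x (P₁.regular-series (x 0) (ℚ-regular x₀₀≢0))
  ; graph = P₂.evaluateAt graph₁ t₂
  ; u~ = P₂.~ˢ-const graph₁ t₂ (P₁.~ˢ-resp (constants coordinateRing) t₁ {P₁.linear ½} {u₁} (λ _ → refl)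
      (ℚ[X₄].solve (Κ ½ ⊕ (Ι 0F ⊕ ⊝ Κ ½)) (Ι 0F) (uᵖ ∷ []) refl)
      (P₁.~ˢ-linear (constants coordinateRing) t₁ {½} {Κ ½} ℚ[X₄].≈-refl))
  ; v~ = P₂.~ˢ-resp graph₁ t₂ {v} {v} (K.≈-refl {v})
      (ℚ[X₄].solve (Κ 1ℚ ⊕ (Ι 0F ⊕ ⊝ Κ 1ℚ)) (Ι 0F) (vᵖ ∷ []) refl)
      (P₂.~ˢ-linear graph₁ t₂ {P₁.const 1ℚ} {Κ 1ℚ}
        (P₁.~ˢ-const (constants coordinateRing) t₁ {1ℚ} {Κ 1ℚ} ℚ[X₄].≈-refl))
  }
  where
  module P₁ = PowerSeries ℚ-algebra
  module P₂ = PowerSeries P₁.seriesRing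
  module K = ℚ-Algebra P₂.seriesRing
  u₁ u₁⁻¹ : P₁.Series
  u₁ = P₁.linear ½
  u₁⁻¹ = P₁.linear⁻¹ {½} {rational 2} refl
  t₁ t₂ : Poly
  t₁ = uᵖ Defs.- Κ ½
  t₂ = vᵖ Defs.- Κ 1ℚ
  v : P₂.Series
  v = P₂.linear (P₁.const 1ℚ)
  graph₁ : P₁.seriesRing ⇀ coordinateRing
  graph₁ = P₁.evaluateAt (constants coordinateRing) t₁

signed : Bool → ℚ → ℚ
signed true  r = r
signed false r = ℚ.- r

-- From (u , v) = (½ , 1) come b = 1/4 and c = 3/4, where a² = 25/16 and d² = 49/16 are both
-- rational squares; thus evaluation at the two roots stays in ℚ.
basePoint : Bool → Bool → Vec ℚ 4
basePoint ε δ = signed ε (+ 5 ℚ./ 4) ∷ + 1 ℚ./ 4 ∷ + 3 ℚ./ 4 ∷ signed δ (+ 7 ℚ./ 4) ∷ []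

-- An embedding of the coordinate ring of X₄ in a ring in which c - b is invertible and
-- regular elements are detected at four points.
record Embedding : Set₁ where
  field
    algebra : ℚ-Algebra
  open ℚ-Algebra algebra public
  field
    generic  : Vec Carrier 4
    generic-onX₄ : OnX₄ algebra generic
    reflect  : ∀ p → ⟦ p ⟧ generic ≈ 0# → p Defs.≈ Defs.0ᵖ
    u⁻¹      : Carrier
    u-inverse : ⟦ Defs.c Defs.- Defs.b ⟧ generic * u⁻¹ ≈ 1#
    evaluation : Bool → Bool → algebra ⟶ ℚ-algebra
    evaluation-generic : ∀ ε δ i → _⟶_.⟦_⟧ (evaluation ε δ) (lookup generic i) ≡ lookup (basePoint ε δ) i
    regular : ∀ x → (∀ ε δ → _⟶_.⟦_⟧ (evaluation ε δ) x ≢ 0ℚ) → x Regular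

module QuadraticTower (base : Base) where
  private
    module K = Base base
    module Kᵖ = Solver K.algebra

    b c : K.Carrier
    b = K.κ ½ K.* (K.v K.- K.u)
    c = K.κ ½ K.* (K.v K.+ K.u)

    a² d² : K.Carrier
    a² = K.⟦ a²-formula ⟧ (b ∷ c ∷ [])
    d² = K.⟦ d²-formula ⟧ (b ∷ c ∷ [])

    module Q₁ = QuadraticExtension K.algebra a²
    module Q₂ = QuadraticExtension Q₁.extension (_⟶_.⟦_⟧ Q₁.inclusion d²)
    module L = ℚ-Algebra Q₂.extension
    module i  = _⟶_ (Q₂.inclusion ∘ʰ Q₁.inclusion)
    module i₂ = _⟶_ Q₂.inclusion
    module K⇀A = _⇀_ K.graph

  generic : Vec L.Carrier 4
  generic = i₂.⟦ Q₁.root ⟧ ∷ i.⟦ b ⟧ ∷ i.⟦ c ⟧ ∷ Q₂.root ∷ []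

  generic-onX₄ : OnX₄ Q₂.extension generic
  generic-onX₄ = onX₄ Q₂.extension
    (L.≈-trans (L.≈-sym (i₂.*-homo Q₁.root Q₁.root)) (L.≈-trans (i₂.cong Q₁.root²) (i-eval a²-formula)))
    (L.≈-trans Q₂.root² (i-eval d²-formula))
    where
    i-eval : ∀ e → i.⟦ K.⟦ e ⟧ (b ∷ c ∷ []) ⟧ L.≈ L.⟦ e ⟧ (i.⟦ b ⟧ ∷ i.⟦ c ⟧ ∷ [])
    i-eval e = i.eval-homo e λ { 0F → L.≈-refl ; 1F → L.≈-refl }

  u-inverse : L.⟦ uᵖ ⟧ generic L.* i.⟦ K.u⁻¹ ⟧ L.≈ L.1#
  u-inverse = L.≈-trans
    (L.*-cong (L.≈-sym (L.≈-trans (i.+-homo c (K.- b)) (L.+-cong L.≈-refl (i.-‿homo b)))) L.≈-refl)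
    (L.≈-trans (L.≈-sym (i.*-homo (c K.- b) K.u⁻¹))
      (L.≈-trans (i.cong (K.≈-trans (K.*-cong c-b≈u K.≈-refl) K.u-inverse)) i.1-homo))
    where
    c-b≈u : c K.- b K.≈ K.u
    c-b≈u = Kᵖ.solve (Κ ½ ⊗ (Ι 1F ⊕ Ι 0F) ⊕ ⊝ (Κ ½ ⊗ (Ι 1F ⊕ ⊝ Ι 0F))) (Ι 0F) (K.u ∷ K.v ∷ []) refl

  -- The backward map pairs the generic point with the coordinates, hence the value of p at the
  -- generic point with p itself, and it pairs zero only with zero.
  reflect : ∀ p → L.⟦ p ⟧ generic L.≈ L.0# → p Defs.≈ Defs.0ᵖ
  reflect p p≈0 = ℚ[X₄].≈-trans (ℚ[X₄].≈-sym (eval-coordinates p)) (L⇀A.~-zero (L⇀A.~-eval p generic~) p≈0)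
    where
    b~ : b K⇀A.~ Defs.b
    b~ = K⇀A.~-resp K.≈-refl
      (ℚ[X₄].solve (Κ ½ ⊗ ((Ι 1F ⊕ Ι 0F) ⊕ ⊝ (Ι 1F ⊕ ⊝ Ι 0F))) (Ι 0F) (Defs.b ∷ Defs.c ∷ []) refl)
      (K⇀A.~-* (K⇀A.~-κ ½) (K⇀A.~-+ K.v~ (K⇀A.~-neg K.u~)))

    c~ : c K⇀A.~ Defs.c
    c~ = K⇀A.~-resp K.≈-refl
      (ℚ[X₄].solve (Κ ½ ⊗ ((Ι 1F ⊕ Ι 0F) ⊕ (Ι 1F ⊕ ⊝ Ι 0F))) (Ι 1F) (Defs.b ∷ Defs.c ∷ []) refl)
      (K⇀A.~-* (K⇀A.~-κ ½) (K⇀A.~-+ K.v~ K.u~))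

    formula~ : ∀ e {p} → ℚ[X₄].⟦ e ⟧ (Defs.b ∷ Defs.c ∷ []) ℚ[X₄].≈ p → K.⟦ e ⟧ (b ∷ c ∷ []) K⇀A.~ p
    formula~ e e≈p = K⇀A.~-resp K.≈-refl e≈p (K⇀A.~-eval e λ { 0F → b~ ; 1F → c~ })

    squares : ℚ[X₄].⟦ a²-formula ⟧ (Defs.b ∷ Defs.c ∷ []) ℚ[X₄].≈ Defs.a ⊗ Defs.a
            × ℚ[X₄].⟦ d²-formula ⟧ (Defs.b ∷ Defs.c ∷ []) ℚ[X₄].≈ Defs.d ⊗ Defs.d
    squares = squares-onX₄ coordinateRing coordinates-onX₄

    a²~ : a² K⇀A.~ Defs.a ⊗ Defs.a
    a²~ = formula~ a²-formula (proj₁ squares)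

    d²~ : _⇀_._~_ (Q₁.rootAt K.graph Defs.a a²~) (_⟶_.⟦_⟧ Q₁.inclusion d²) (Defs.d ⊗ Defs.d)
    d²~ = Q₁.~-inclusion K.graph Defs.a a²~ (formula~ d²-formula (proj₂ squares))

    graph₁ : Q₁.extension ⇀ coordinateRing
    graph₁ = Q₁.rootAt K.graph Defs.a a²~

    graph₂ : Q₂.extension ⇀ coordinateRing
    graph₂ = Q₂.rootAt graph₁ Defs.d d²~

    module L⇀A = _⇀_ graph₂

    generic~ : ∀ i → lookup generic i L⇀A.~ lookup coordinates i
    generic~ 0F = Q₂.~-inclusion graph₁ Defs.d d²~ (Q₁.~-root K.graph Defs.a a²~)
    generic~ 1F = Q₂.~-inclusion graph₁ Defs.d d²~ (Q₁.~-inclusion K.graph Defs.a a²~ b~)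
    generic~ 2F = Q₂.~-inclusion graph₁ Defs.d d²~ (Q₁.~-inclusion K.graph Defs.a a²~ c~)
    generic~ 3F = Q₂.~-root graph₁ Defs.d d²~

  private
    a₀ d₀ : ℚ
    a₀ = + 5 ℚ./ 4
    d₀ = + 7 ℚ./ 4

    module e₀ = _⟶_ K.evaluation

    e₀-uv : ∀ e → e₀.⟦ K.⟦ e ⟧ (K.u ∷ K.v ∷ []) ⟧ ≡ ℚ-Algebra.⟦_⟧ ℚ-algebra e (½ ∷ 1ℚ ∷ [])
    e₀-uv e = e₀.eval-homo e λ { 0F → K.evaluation-u ; 1F → K.evaluation-v }

    bᵉ cᵉ : Expr ℚ 2
    bᵉ = Κ ½ ⊗ (Ι 1F ⊕ ⊝ Ι 0F)
    cᵉ = Κ ½ ⊗ (Ι 1F ⊕ Ι 0F)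

    e₀-bc : ∀ e → e₀.⟦ K.⟦ e ⟧ (b ∷ c ∷ []) ⟧ ≡ ℚ-Algebra.⟦_⟧ ℚ-algebra e (+ 1 ℚ./ 4 ∷ + 3 ℚ./ 4 ∷ [])
    e₀-bc e = e₀.eval-homo e λ { 0F → e₀-uv bᵉ ; 1F → e₀-uv cᵉ }

    a₀² : ∀ ε → signed ε a₀ ℚ.* signed ε a₀ ≡ e₀.⟦ a² ⟧
    a₀² true  = ≡.sym (e₀-bc a²-formula)
    a₀² false = ≡.sym (e₀-bc a²-formula)

    module e₁ (ε : Bool) = _⟶_ (Q₁.extend K.evaluation (signed ε a₀) (a₀² ε))

    e₁-inclusion : ∀ ε x → e₁.⟦_⟧ ε (_⟶_.⟦_⟧ Q₁.inclusion x) ≡ e₀.⟦ x ⟧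
    e₁-inclusion ε = Q₁.extend-inclusion K.evaluation (signed ε a₀) (a₀² ε)

    d₀² : ∀ ε δ → signed δ d₀ ℚ.* signed δ d₀ ≡ e₁.⟦_⟧ ε (_⟶_.⟦_⟧ Q₁.inclusion d²)
    d₀² ε true  = ≡.sym (≡.trans (e₁-inclusion ε d²) (e₀-bc d²-formula))
    d₀² ε false = ≡.sym (≡.trans (e₁-inclusion ε d²) (e₀-bc d²-formula))

    e₁-hom : Bool → Q₁.extension ⟶ ℚ-algebra
    e₁-hom ε = Q₁.extend K.evaluation (signed ε a₀) (a₀² ε)

  evaluation : Bool → Bool → Q₂.extension ⟶ ℚ-algebra
  evaluation ε δ = Q₂.extend (e₁-hom ε) (signed δ d₀) (d₀² ε δ)

  private
    module e₂ (ε δ : Bool) = _⟶_ (evaluation ε δ)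

    e₂-inclusion : ∀ ε δ x → e₂.⟦_⟧ ε δ i₂.⟦ x ⟧ ≡ e₁.⟦_⟧ ε x
    e₂-inclusion ε δ = Q₂.extend-inclusion (e₁-hom ε) (signed δ d₀) (d₀² ε δ)

  evaluation-generic : ∀ ε δ i → e₂.⟦_⟧ ε δ (lookup generic i) ≡ lookup (basePoint ε δ) i
  evaluation-generic ε δ 0F = ≡.trans (e₂-inclusion ε δ Q₁.root) (Q₁.extend-root K.evaluation (signed ε a₀) (a₀² ε))
  evaluation-generic ε δ 1F = ≡.trans (e₂-inclusion ε δ _) (≡.trans (e₁-inclusion ε b) (e₀-uv bᵉ))
  evaluation-generic ε δ 2F = ≡.trans (e₂-inclusion ε δ _) (≡.trans (e₁-inclusion ε c) (e₀-uv cᵉ))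
  evaluation-generic ε δ 3F = Q₂.extend-root (e₁-hom ε) (signed δ d₀) (d₀² ε δ)

  -- Taking norms twice lands in K, at an element whose value at (½ , 1) is the product of the four
  -- values of x. That element is regular, and regularity climbs back up through the two norms.
  regular : ∀ x → (∀ ε δ → e₂.⟦_⟧ ε δ x ≢ 0ℚ) → x L.Regular
  regular (x , y) x≢0 =
    Q₂.regular-norm x y (Q₁.regular-norm (proj₁ n) (proj₂ n) (K.regular (n₀ n) n₀≢0))
    where
    module M = ℚ-Algebra Q₁.extension
    n : M.Carrier
    n = x M.* x M.- _⟶_.⟦_⟧ Q₁.inclusion d² M.* (y M.* y)
    n₀ : M.Carrier → K.Carrier
    n₀ (z , w) = z K.* z K.- a² K.* (w K.* w)
    n≢0 : ∀ ε → e₁.⟦_⟧ ε n ≢ 0ℚ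
    n≢0 ε = ≡.subst (_≢ 0ℚ) (≡.sym (Q₂.extend-norm (e₁-hom ε) (signed true d₀) (d₀² ε true) x y))
      (*-≢0 (x≢0 ε true) (x≢0 ε false))
    n₀≢0 : e₀.⟦ n₀ n ⟧ ≢ 0ℚ
    n₀≢0 = ≡.subst (_≢ 0ℚ) (≡.sym (Q₁.extend-norm K.evaluation (signed true a₀) (a₀² true) (proj₁ n) (proj₂ n)))
      (*-≢0 (n≢0 true) (n≢0 false))

  embedding : Embedding
  embedding = record
    { algebra = Q₂.extension ; generic = generic ; generic-onX₄ = generic-onX₄ ; reflect = reflect
    ; u⁻¹ = i.⟦ K.u⁻¹ ⟧ ; u-inverse = u-inverse
    ; evaluation = evaluation ; evaluation-generic = evaluation-generic ; regular = regular }

-- Values of rational maps and dense denominators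

module RegularElements (B : ℚ-Algebra) where
  open ℚ-Algebra B
  open Solver B

  regular-* : ∀ {x y} → x Regular → y Regular → (x * y) Regular
  regular-* rx ry z xyz≈0 = ry z (rx _ (≈-trans (≈-sym (*-assoc _ _ _)) xyz≈0))

  regular-resp : ∀ {x y} → x ≈ y → x Regular → y Regular
  regular-resp x≈y rx z yz≈0 = rx z (≈-trans (*-cong x≈y ≈-refl) yz≈0)

  regular-1 : 1# Regular
  regular-1 z z≈0 = ≈-trans (≈-sym (*-identityˡ z)) z≈0

  unit-regular : ∀ {x x⁻¹} → x * x⁻¹ ≈ 1# → x Regular
  unit-regular {x} {x⁻¹} inverse z xz≈0 = ≈-trans (≈-sym (*-identityˡ z))
    (≈-trans (*-cong (≈-sym inverse) ≈-refl)
    (≈-trans (solve (Ι 0F ⊗ Ι 1F ⊗ Ι 2F) (Ι 1F ⊗ (Ι 0F ⊗ Ι 2F)) (x ∷ x⁻¹ ∷ z ∷ []) refl)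
    (≈-trans (*-cong ≈-refl xz≈0) (zeroʳ _))))

  regular-cancel : ∀ {x} → x Regular → ∀ {y z} → x * y ≈ x * z → y ≈ z
  regular-cancel {x} rx {y} {z} xy≈xz = ≈-trans (≈-sym (+-identityʳ y))
    (≈-trans (+-cong ≈-refl (≈-sym (-‿inverseˡ z)))
    (≈-trans (≈-sym (+-assoc y (- z) z))
    (≈-trans (+-cong (rx _ x[y-z]≈0) ≈-refl) (+-identityˡ z))))
    where
    x[y-z]≈0 : x * (y - z) ≈ 0#
    x[y-z]≈0 = ≈-trans (solve (Ι 0F ⊗ (Ι 1F ⊕ ⊝ Ι 2F)) (Ι 0F ⊗ Ι 1F ⊕ ⊝ (Ι 0F ⊗ Ι 2F)) (x ∷ y ∷ z ∷ []) refl)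
      (≈-trans (+-cong xy≈xz ≈-refl) (-‿inverseʳ _))

module Values (B : ℚ-Algebra) where
  open ℚ-Algebra B
  open Solver B
  open RegularElements B

  infix 3 _at_≔_ _at_≔*_
  -- Regularity makes y unique without division. At the generic point a regular denominator is dense
  -- on X₄; over ℚ it is simply nonzero.
  record _at_≔_ (f : Quotient) (ρ : Vec Carrier 4) (y : Carrier) : Set where
    constructor _,_
    field
      den-regular : ⟦ den f ⟧ ρ Regular
      num-value   : ⟦ num f ⟧ ρ ≈ y * ⟦ den f ⟧ ρ
  open _at_≔_ public

  _at_≔*_ : ∀ {n} → Vec Quotient n → Vec Carrier 4 → Vec Carrier n → Set
  F at ρ ≔* v = ∀ i → lookup F i at ρ ≔ lookup v i

  at-resp : ∀ {f ρ y y′} → y ≈ y′ → f at ρ ≔ y → f at ρ ≔ y′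
  at-resp y≈y′ (r , e) = r , ≈-trans e (*-cong y≈y′ ≈-refl)

  polynomial-at : ∀ p {ρ} → p // Defs.1ᵖ at ρ ≔ ⟦ p ⟧ ρ
  polynomial-at p = regular-resp (≈-sym κ-1) regular-1 , ≈-sym (≈-trans (*-cong ≈-refl κ-1) (*-identityʳ _))

  eval-at : ∀ {n} (e : Expr ℚ n) {G : Vec Quotient n} {ρ v} → G at ρ ≔* v →
            Eval.⟦_⟧ quotientRawRing (λ r → Κ r // Defs.1ᵖ) e G at ρ ≔ ⟦ e ⟧ v
  eval-at e {ρ = ρ} = eval-rel quotientRawRing rawRing (λ f y → f at ρ ≔ y)
    (λ { {f} {x} {g} {y} (r , p) (t , q) → regular-* r t , ≈-trans
        (+-cong (*-cong p ≈-refl) (*-cong q ≈-refl))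
        (solve (Ι 0F ⊗ Ι 1F ⊗ Ι 3F ⊕ Ι 2F ⊗ Ι 3F ⊗ Ι 1F) ((Ι 0F ⊕ Ι 2F) ⊗ (Ι 1F ⊗ Ι 3F))
          (x ∷ ⟦ den f ⟧ ρ ∷ y ∷ ⟦ den g ⟧ ρ ∷ []) refl) })
    (λ { {f} {x} {g} {y} (r , p) (t , q) → regular-* r t , ≈-trans (*-cong p q)
        (solve (Ι 0F ⊗ Ι 1F ⊗ (Ι 2F ⊗ Ι 3F)) (Ι 0F ⊗ Ι 2F ⊗ (Ι 1F ⊗ Ι 3F))
          (x ∷ ⟦ den f ⟧ ρ ∷ y ∷ ⟦ den g ⟧ ρ ∷ []) refl) })
    (λ { {f} {x} (r , p) → r , ≈-trans (-‿cong p)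
        (solve (⊝ (Ι 0F ⊗ Ι 1F)) (⊝ (Ι 0F) ⊗ Ι 1F) (x ∷ ⟦ den f ⟧ ρ ∷ []) refl) })
    (regular-resp (≈-sym κ-1) regular-1 , ≈-sym (*-identityˡ _))
    (λ r → polynomial-at (Κ r))
    e

  ÷-at : ∀ {f g ρ x y z} → f at ρ ≔ x → g at ρ ≔ y → y Regular → x ≈ z * y → f Defs.÷ g at ρ ≔ z
  ÷-at {f} {g} {ρ} {x} {y} {z} (r , p) (t , q) ry x≈zy =
      regular-* r (regular-resp (≈-sym q) (regular-* ry t))
    , ≈-trans (*-cong (≈-trans p (*-cong x≈zy ≈-refl)) ≈-refl) (≈-trans
        (solve (Ι 0F ⊗ Ι 1F ⊗ Ι 2F ⊗ Ι 3F) (Ι 0F ⊗ (Ι 2F ⊗ (Ι 1F ⊗ Ι 3F)))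
          (z ∷ y ∷ ⟦ den f ⟧ ρ ∷ ⟦ den g ⟧ ρ ∷ []) refl)
        (*-cong ≈-refl (*-cong ≈-refl (≈-sym q))))

  -- The denominators of F are taken at v, the value of G. This is why nondegeneracy has to be known
  -- at every point of the generic orbit.
  ⊚-at : ∀ {F G ρ v v′} → F at v ≔* v′ → G at ρ ≔* v → F ⊚ G at ρ ≔* v′
  ⊚-at {F} {G} {ρ} {v} {v′} F-at G-at i = ≡.subst (_at ρ ≔ lookup v′ i) (≡.sym (lookup-map i _ F))
    (÷-at (eval-at (num (lookup F i)) G-at) (eval-at (den (lookup F i)) G-at) (den-regular (F-at i)) (num-value (F-at i)))

module Density (embedding : Embedding) where
  open Embedding embedding
  open Solver algebra
  open RegularElements algebra
  open Values algebra

  -- Since the embedding reflects zero, p can be cancelled in ℚ[X₄] too, and the m factors p of (p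
  -- k)ᵐ are removed one at a time.
  regular⇒dense : ∀ {p} → ⟦ p ⟧ generic Regular → Defs.Dense p
  regular⇒dense {p} reg k (m , pkᵐ≈0) = m , ℚ[X₄].≈-trans (ℚ[X₄].≈-sym (ℚ[X₄].*-identityʳ _))
    (cancel m Defs.1ᵖ (ℚ[X₄].≈-trans (ℚ[X₄].*-cong pkᵐ≈0 ℚ[X₄].≈-refl) (ℚ[X₄].zeroˡ _)))
    where
    cancel₁ : ∀ q → p ⊗ q ℚ[X₄].≈ Defs.0ᵖ → q ℚ[X₄].≈ Defs.0ᵖ
    cancel₁ q pq≈0 = reflect q (reg _ (≈-trans (eval-sound algebra generic-onX₄ pq≈0) κ-0))

    -- `q` collects the copies of p k already split off from the power.
    cancel : ∀ m q → (p ⊗ k) ⊛ m ⊗ q ℚ[X₄].≈ Defs.0ᵖ → k ⊛ m ⊗ q ℚ[X₄].≈ Defs.0ᵖ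
    cancel zero q e = ℚ[X₄].≈-trans (ℚ[X₄].*-cong (ℚ[X₄].≈-trans (Defs.^-zero k) (ℚ[X₄].≈-sym (Defs.^-zero (p ⊗ k)))) ℚ[X₄].≈-refl) e
    cancel (suc m) q e = cancel₁ _ (ℚ[X₄].≈-trans
      (ℚ[X₄].≈-trans (ℚ[X₄].*-cong ℚ[X₄].≈-refl (ℚ[X₄].*-cong (Defs.^-suc k m) ℚ[X₄].≈-refl))
        (ℚ[X₄].solve (Ι 0F ⊗ (Ι 1F ⊗ Ι 2F ⊗ Ι 3F)) (Ι 2F ⊗ (Ι 0F ⊗ Ι 1F ⊗ Ι 3F)) (p ∷ k ∷ k ⊛ m ∷ q ∷ []) refl))
      (cancel m (p ⊗ k ⊗ q) (ℚ[X₄].≈-trans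
        (ℚ[X₄].≈-trans
          (ℚ[X₄].solve (Ι 0F ⊗ (Ι 1F ⊗ Ι 2F)) (Ι 1F ⊗ Ι 0F ⊗ Ι 2F) ((p ⊗ k) ⊛ m ∷ p ⊗ k ∷ q ∷ []) refl)
          (ℚ[X₄].*-cong (ℚ[X₄].≈-sym (Defs.^-suc (p ⊗ k) m)) ℚ[X₄].≈-refl))
        e)))

  -- Both cross products equal y · den f · den g at the generic point, so no further shrinking of
  -- the open set is necessary and the exponent is 1.
  same-value⇒∼ : ∀ {f g y} → f at generic ≔ y → g at generic ≔ y → f Defs.∼ g
  same-value⇒∼ {f} {g} {y} (rf , ef) (rg , eg) =
      Defs.1ᵖ
    , regular⇒dense (regular-* (regular-* (regular-resp (≈-sym κ-1) regular-1) rf) rg)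
    , 1 , reflect ((Defs.1ᵖ ⊗ den f ⊗ den g ⊗ (num f ⊗ den g Defs.- num g ⊗ den f)) ⊛ 1) (≈-trans
        (*-cong ≈-refl (≈-trans (+-cong (*-cong ef ≈-refl) (-‿cong (*-cong eg ≈-refl)))
          (≈-trans (+-cong
            (solve (Ι 0F ⊗ Ι 1F ⊗ Ι 2F) (Ι 0F ⊗ Ι 2F ⊗ Ι 1F) (y ∷ ⟦ den f ⟧ generic ∷ ⟦ den g ⟧ generic ∷ []) refl) ≈-refl)
            (-‿inverseʳ _))))
        (zeroʳ _))

-- The conic fibration

private
  sᵉ uᵉ wᵉ : Expr ℚ 3
  sᵉ = Ι 0F
  uᵉ = Ι 1F
  wᵉ = Ι 2F

  infixl 6 _⊖_
  _⊖_ : ∀ {n} → Expr ℚ n → Expr ℚ n → Expr ℚ n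
  e ⊖ f = e ⊕ ⊝ f

quarter : ∀ {n} → Expr ℚ n
quarter = Κ (+ 1 ℚ./ 4)

-- In the variables (s , u , w), with u = c - b, w = (d - a) / 3 and s = (a + d) / u.
parametrization : Vec (Expr ℚ 3) 4
parametrization = Κ ½ ⊗ (sᵉ ⊗ uᵉ ⊖ nat 3 ⊗ wᵉ)
                ∷ Κ ½ ⊗ (sᵉ ⊗ wᵉ ⊖ uᵉ)
                ∷ Κ ½ ⊗ (sᵉ ⊗ wᵉ ⊕ uᵉ)
                ∷ Κ ½ ⊗ (sᵉ ⊗ uᵉ ⊕ nat 3 ⊗ wᵉ)
                ∷ []

rotation : Vec (Expr ℚ 3) 3
rotation = sᵉ
         ∷ quarter ⊗ ((sᵉ ⊗ sᵉ ⊖ nat 5) ⊗ uᵉ ⊕ (sᵉ ⊗ sᵉ ⊖ nat 9) ⊗ wᵉ)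
         ∷ quarter ⊗ ((sᵉ ⊗ sᵉ ⊖ nat 1) ⊗ uᵉ ⊕ (sᵉ ⊗ sᵉ ⊖ nat 5) ⊗ wᵉ)
         ∷ []

conic : Expr ℚ 3
conic = (sᵉ ⊗ sᵉ ⊖ nat 1) ⊗ (uᵉ ⊗ uᵉ) ⊕ (nat 9 ⊖ sᵉ ⊗ sᵉ) ⊗ (wᵉ ⊗ wᵉ)

τμ-parametrization : Vec (Expr ℚ 3) 4
τμ-parametrization = ⊝ lookup parametrization 3F ∷ lookup parametrization 2F
                   ∷ lookup parametrization 1F ∷ ⊝ lookup parametrization 0F ∷ []

-- cofactor i = (pᵢ - q xᵢ′) / (conic - 8), where pᵢ and q are taken at τμ₁₄ of the parametrized
-- point and xᵢ′ is the i-th coordinate of the rotated point.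
cofactor : Fin 4 → Expr ℚ 3
cofactor i = Κ (+ 1 ℚ./ 16) ⊗ (nat 4 ⊕ sᵉ ⊗ (uᵉ ⊕ wᵉ) ⊗ (sᵉ ⊗ (uᵉ ⊕ wᵉ) ⊕ k i ⊗ uᵉ)) ⊖ l i ⊗ (uᵉ ⊗ uᵉ)
  where
  k : Fin 4 → Expr ℚ 3
  k 0F = nat 0
  k 1F = nat 2
  k 2F = nat 4
  k 3F = nat 6
  l : Fin 4 → Expr ℚ 3
  l 0F = quarter
  l _  = nat 0

wᵖ : Poly
wᵖ = Κ (+ 1 ℚ./ 3) ⊗ (Defs.d Defs.- Defs.a)

_⟨_⟩ : ∀ {m n} → Vec (Expr ℚ m) n → Vec Quotient m → Vec Quotient n
es ⟨ G ⟩ = map (λ e → Eval.⟦_⟧ quotientRawRing (λ r → Κ r // Defs.1ᵖ) e G) es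

-- Only s brings in a denominator and `rotation` is polynomial, so all denominators here are
-- products of c - b and 1, unlike those of the composed iterates of ζ.
fibreCoordinates : ℕ → Vec Quotient 3
fibreCoordinates zero    = (Defs.a ⊕ Defs.d // uᵖ) ∷ (uᵖ // Defs.1ᵖ) ∷ (wᵖ // Defs.1ᵖ) ∷ []
fibreCoordinates (suc n) = rotation ⟨ fibreCoordinates n ⟩

iterate : ℕ → RatMap
iterate n = parametrization ⟨ fibreCoordinates n ⟩

module Fibration (B : ℚ-Algebra) where
  open ℚ-Algebra B
  open Solver B
  open RegularElements B
  open Values B

  ⟦_⟧* : ∀ {m n} → Vec (Expr ℚ m) n → Vec Carrier m → Vec Carrier n
  ⟦ es ⟧* v = map (λ e → ⟦ e ⟧ v) es

  rotations : ℕ → Vec Carrier 3 → Vec Carrier 3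
  rotations zero    v = v
  rotations (suc n) v = ⟦ rotation ⟧* (rotations n v)

  ⟨⟩-at : ∀ {m n} (es : Vec (Expr ℚ m) n) {G ρ v} → G at ρ ≔* v → es ⟨ G ⟩ at ρ ≔* ⟦ es ⟧* v
  ⟨⟩-at es {G} {ρ} {v} G-at i =
    ≡.subst₂ (_at ρ ≔_) (≡.sym (lookup-map i _ es)) (≡.sym (lookup-map i _ es)) (eval-at (lookup es i) G-at)

  fibreCoordinates-at : ∀ {ρ v} n → fibreCoordinates 0 at ρ ≔* v → fibreCoordinates n at ρ ≔* rotations n v
  fibreCoordinates-at zero    h = h
  fibreCoordinates-at {v = v} (suc n) h =
    ⟨⟩-at rotation {G = fibreCoordinates n} {v = rotations n v} (fibreCoordinates-at {v = v} n h)

  iterate-at : ∀ {ρ v} n → fibreCoordinates 0 at ρ ≔* v → iterate n at ρ ≔* ⟦ parametrization ⟧* (rotations n v)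
  iterate-at {v = v} n h =
    ⟨⟩-at parametrization {G = fibreCoordinates n} {v = rotations n v} (fibreCoordinates-at {v = v} n h)

  OnConic : Vec Carrier 3 → Set
  OnConic v = ⟦ conic ⟧ v ≈ κ (rational 8)

  -- For fixed s the rotation is an isometry of the quadratic form, so `conic` is preserved
  -- identically and not just on the level set 8.
  rotation-conic : ∀ {v} → OnConic v → OnConic (⟦ rotation ⟧* v)
  rotation-conic {v} h = ≈-trans (≈-sym (eval-substitute conic rotation v))
    (≈-trans (solve (substitute conic rotation) conic v refl) h)

  -- The factors of the denominator of ζ: at τμ₁₄ of the parametrized point, q equals -½ u² (s + 3)
  -- (u + w).
  record Nondegenerate (v : Vec Carrier 3) : Set where
    constructor nondegenerate
    field
      u-regular   : lookup v 1F Regular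
      s+3-regular : (lookup v 0F + κ (rational 3)) Regular
      u+w-regular : (lookup v 1F + lookup v 2F) Regular
  open Nondegenerate public

  -- `k` is an explicit quotient of e - f g by r - s, which turns an equality valid only on the
  -- fibre into a polynomial identity for the normaliser.
  modulo : ∀ {n} {v : Vec Carrier n} e f g k r s → ⟦ r ⟧ v ≈ ⟦ s ⟧ v →
           norm e ≡ norm (f ⊗ g ⊕ k ⊗ (r ⊕ ⊝ s)) → ⟦ e ⟧ v ≈ ⟦ f ⟧ v * ⟦ g ⟧ v
  modulo {v = v} e f g k r s r≈s eq = ≈-trans (solve e (f ⊗ g ⊕ k ⊗ (r ⊕ ⊝ s)) v eq)
    (≈-trans (+-cong ≈-refl (≈-trans (*-cong ≈-refl (≈-trans (+-cong r≈s ≈-refl) (-‿inverseʳ _))) (zeroʳ _)))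
      (+-identityʳ _))

  ζ-at : ∀ {v} → OnConic v → Nondegenerate v →
         Defs.ζ at ⟦ parametrization ⟧* v ≔* ⟦ parametrization ⟧* (⟦ rotation ⟧* v)
  ζ-at {v} h nd = ⊚-at {F = Defs.φ} {G = Defs.τ ⊚ Defs.μ₁₄} {v = ⟦ τμ-parametrization ⟧* v}
    {v′ = ⟦ parametrization ⟧* (⟦ rotation ⟧* v)} φ-at
    (⊚-at {F = Defs.τ} {G = Defs.μ₁₄} {v = ⟦ μ-parametrization ⟧* v} {v′ = ⟦ τμ-parametrization ⟧* v}
      (λ { 0F → polynomial-at Defs.d ; 1F → polynomial-at Defs.c
         ; 2F → polynomial-at Defs.b ; 3F → polynomial-at Defs.a })
      (λ { 0F → polynomial-at (⊝ Defs.a) ; 1F → polynomial-at Defs.b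
         ; 2F → polynomial-at Defs.c ; 3F → polynomial-at (⊝ Defs.d) }))
    where
    μ-parametrization : Vec (Expr ℚ 3) 4
    μ-parametrization = ⊝ lookup parametrization 0F ∷ lookup parametrization 1F
                      ∷ lookup parametrization 2F ∷ ⊝ lookup parametrization 3F ∷ []

    q-regular : ⟦ Defs.q ⟧ (⟦ τμ-parametrization ⟧* v) Regular
    q-regular = regular-resp
      (≈-trans (solve (Κ (ℚ.- ½) ⊗ (Ι 1F ⊗ Ι 1F) ⊗ (Ι 0F ⊕ nat 3) ⊗ (Ι 1F ⊕ Ι 2F))
                  (substitute Defs.q τμ-parametrization) v refl)
        (eval-substitute Defs.q τμ-parametrization v))
      (regular-* (regular-* (regular-* -½-regular (regular-* (u-regular nd) (u-regular nd))) (s+3-regular nd))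
        (u+w-regular nd))
      where
      -½-regular : κ (ℚ.- ½) Regular
      -½-regular = unit-regular {x⁻¹ = κ (ℚ.- (rational 2))} (≈-trans (≈-sym (κ-* _ _)) κ-1)

    numerator : ∀ p e k →
      norm (substitute p τμ-parametrization) ≡
      norm (substitute e rotation ⊗ substitute Defs.q τμ-parametrization ⊕ k ⊗ (conic ⊕ ⊝ nat 8)) →
      ⟦ p ⟧ (⟦ τμ-parametrization ⟧* v) ≈ ⟦ e ⟧ (⟦ rotation ⟧* v) * ⟦ Defs.q ⟧ (⟦ τμ-parametrization ⟧* v)
    numerator p e k eq = ≈-trans (≈-sym (eval-substitute p τμ-parametrization v))
      (≈-trans
        (modulo (substitute p τμ-parametrization) (substitute e rotation)
          (substitute Defs.q τμ-parametrization) k conic (nat 8) h eq)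
        (*-cong (eval-substitute e rotation v) (eval-substitute Defs.q τμ-parametrization v)))

    φ-at : Defs.φ at ⟦ τμ-parametrization ⟧* v ≔* ⟦ parametrization ⟧* (⟦ rotation ⟧* v)
    φ-at 0F = q-regular , numerator Defs.p₁ (lookup parametrization 0F) (cofactor 0F) refl
    φ-at 1F = q-regular , numerator Defs.p₂ (lookup parametrization 1F) (cofactor 1F) refl
    φ-at 2F = q-regular , numerator Defs.p₃ (lookup parametrization 2F) (cofactor 2F) refl
    φ-at 3F = q-regular , numerator Defs.p₄ (lookup parametrization 3F) (cofactor 3F) refl

  module _ {a b c d : Carrier} (onX₄ : OnX₄ B (a ∷ b ∷ c ∷ d ∷ []))
           (u-regular : (c - b) Regular) {s : Carrier} (s-ratio : s * (c - b) ≈ a + d) where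
    private
      w : Carrier
      w = κ (+ 1 ℚ./ 3) * (d - a)

      v : Vec Carrier 3
      v = s ∷ c - b ∷ w ∷ []

      a²≈ : a * a ≈ ⟦ a²-formula ⟧ (b ∷ c ∷ [])
      a²≈ = ≈-sym (proj₁ (squares-onX₄ B onX₄))

      d²≈ : d * d ≈ ⟦ d²-formula ⟧ (b ∷ c ∷ [])
      d²≈ = ≈-sym (proj₂ (squares-onX₄ B onX₄))

      -- On X₄, 3 s u w = (a + d) (d - a) = d² - a² = 3 (c² - b²) = 3 u (b + c), and u cancels.
      sw≈b+c : s * w ≈ b + c
      sw≈b+c = regular-cancel u-regular (≈-trans
        (solve ((Ι 2F ⊕ ⊝ Ι 1F) ⊗ (Ι 4F ⊗ (Κ (+ 1 ℚ./ 3) ⊗ (Ι 3F ⊕ ⊝ Ι 0F))))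
          (Κ (+ 1 ℚ./ 3) ⊗ ((Ι 4F ⊗ (Ι 2F ⊕ ⊝ Ι 1F)) ⊗ (Ι 3F ⊕ ⊝ Ι 0F)))
          (a ∷ b ∷ c ∷ d ∷ s ∷ []) refl)
        (≈-trans (*-cong ≈-refl (≈-trans (*-cong s-ratio ≈-refl) (≈-trans
            (solve ((Ι 0F ⊕ Ι 1F) ⊗ (Ι 1F ⊕ ⊝ Ι 0F)) (Ι 1F ⊗ Ι 1F ⊕ ⊝ (Ι 0F ⊗ Ι 0F)) (a ∷ d ∷ []) refl)
            (+-cong d²≈ (-‿cong a²≈)))))
          (solve (Κ (+ 1 ℚ./ 3) ⊗ (d²-formula ⊕ ⊝ a²-formula)) ((Ι 1F ⊕ ⊝ Ι 0F) ⊗ (Ι 0F ⊕ Ι 1F))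
            (b ∷ c ∷ []) refl)))

    -- With s u = a + d and s w = b + c the form is (a + d)² - (c - b)² + (d - a)² - (b + c)² = 2
    -- (a² + d²) - 2 (b² + c²), and a² + d² = b² + c² + 4 on X₄.
    fibre-conic : OnConic v
    fibre-conic = ≈-trans
      (solve conic ((Ι 0F ⊗ Ι 1F) ⊗ (Ι 0F ⊗ Ι 1F) ⊕ ⊝ (Ι 1F ⊗ Ι 1F) ⊕ nat 9 ⊗ (Ι 2F ⊗ Ι 2F)
        ⊕ ⊝ ((Ι 0F ⊗ Ι 2F) ⊗ (Ι 0F ⊗ Ι 2F))) v refl)
      (≈-trans (+-cong (+-cong (+-cong (*-cong s-ratio s-ratio) ≈-refl) ≈-refl) (-‿cong (*-cong sw≈b+c sw≈b+c)))
      (≈-trans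
        (solve ((Ι 0F ⊕ Ι 3F) ⊗ (Ι 0F ⊕ Ι 3F) ⊕ ⊝ ((Ι 2F ⊕ ⊝ Ι 1F) ⊗ (Ι 2F ⊕ ⊝ Ι 1F))
            ⊕ nat 9 ⊗ ((Κ (+ 1 ℚ./ 3) ⊗ (Ι 3F ⊕ ⊝ Ι 0F)) ⊗ (Κ (+ 1 ℚ./ 3) ⊗ (Ι 3F ⊕ ⊝ Ι 0F)))
            ⊕ ⊝ ((Ι 1F ⊕ Ι 2F) ⊗ (Ι 1F ⊕ Ι 2F)))
          (nat 2 ⊗ (Ι 0F ⊗ Ι 0F ⊕ Ι 3F ⊗ Ι 3F) ⊕ ⊝ (nat 2 ⊗ (Ι 1F ⊗ Ι 1F ⊕ Ι 2F ⊗ Ι 2F)))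
          (a ∷ b ∷ c ∷ d ∷ []) refl)
      (≈-trans (+-cong (*-cong ≈-refl (+-cong a²≈ d²≈)) ≈-refl)
        (solve (nat 2 ⊗ (a²-formula ⊕ d²-formula) ⊕ ⊝ (nat 2 ⊗ (Ι 0F ⊗ Ι 0F ⊕ Ι 1F ⊗ Ι 1F))) (nat 8)
          (b ∷ c ∷ []) refl))))

    fibre-point : ∀ i → lookup (⟦ parametrization ⟧* v) i ≈ lookup (a ∷ b ∷ c ∷ d ∷ []) i
    fibre-point 0F = ≈-trans (*-cong ≈-refl (+-cong s-ratio ≈-refl))
      (solve (Κ ½ ⊗ (Ι 0F ⊕ Ι 1F ⊕ ⊝ (nat 3 ⊗ (Κ (+ 1 ℚ./ 3) ⊗ (Ι 1F ⊕ ⊝ Ι 0F))))) (Ι 0F) (a ∷ d ∷ []) refl)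
    fibre-point 1F = ≈-trans (*-cong ≈-refl (+-cong sw≈b+c ≈-refl))
      (solve (Κ ½ ⊗ (Ι 0F ⊕ Ι 1F ⊕ ⊝ (Ι 1F ⊕ ⊝ Ι 0F))) (Ι 0F) (b ∷ c ∷ []) refl)
    fibre-point 2F = ≈-trans (*-cong ≈-refl (+-cong sw≈b+c ≈-refl))
      (solve (Κ ½ ⊗ (Ι 0F ⊕ Ι 1F ⊕ (Ι 1F ⊕ ⊝ Ι 0F))) (Ι 1F) (b ∷ c ∷ []) refl)
    fibre-point 3F = ≈-trans (*-cong ≈-refl (+-cong s-ratio ≈-refl))
      (solve (Κ ½ ⊗ (Ι 0F ⊕ Ι 1F ⊕ nat 3 ⊗ (Κ (+ 1 ℚ./ 3) ⊗ (Ι 1F ⊕ ⊝ Ι 0F)))) (Ι 1F) (a ∷ d ∷ []) refl)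

-- Orbits of the four base points

open Solver ℚ-algebra using () renaming (solve to ℚ-solve)

private
  rotate : Vec ℚ 3 → Vec ℚ 3
  rotate v = map (λ e → ℚ-Algebra.⟦_⟧ ℚ-algebra e v) rotation


square-nonNegative : ∀ p → NonNegative (p ℚ.* p)
square-nonNegative p with ℚ.≤-total 0ℚ p
... | inj₁ 0≤p = ℚ.nonNeg*nonNeg⇒nonNeg p {{ℚ.nonNegative 0≤p}} p {{ℚ.nonNegative 0≤p}}
... | inj₂ p≤0 = ℚ.nonPos*nonPos⇒nonPos p {{ℚ.nonPositive p≤0}} p {{ℚ.nonPositive p≤0}}

positive-≢0 : ∀ {p} → Positive p → p ≢ 0ℚ
positive-≢0 () refl

product-positive⇒u≢0 : ∀ u w → Positive (u ℚ.* w) → u ≢ 0ℚ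
product-positive⇒u≢0 u w uw>0 refl = positive-≢0 uw>0 (ℚ.*-zeroˡ w)

-- u (u + w) = u² + u w is positive.
product-positive⇒u+w≢0 : ∀ u w → Positive (u ℚ.* w) → u ℚ.+ w ≢ 0ℚ
product-positive⇒u+w≢0 u w uw>0 u+w≡0 = positive-≢0
  (ℚ.nonNeg+pos⇒pos (u ℚ.* u) {{square-nonNegative u}} (u ℚ.* w) {{uw>0}})
  (≡.trans (≡.sym (ℚ.*-distribˡ-+ u u w)) (≡.trans (≡.cong (u ℚ.*_) u+w≡0) (ℚ.*-zeroʳ u)))

quadraticForm-positive : ∀ p q r u w → NonNegative p → Positive q → NonNegative r → Positive (u ℚ.* w) →
  Positive (p ℚ.* (u ℚ.* u) ℚ.+ q ℚ.* (u ℚ.* w) ℚ.+ r ℚ.* (w ℚ.* w))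
quadraticForm-positive p q r u w p≥0 q>0 r≥0 uw>0 =
  ℚ.pos+nonNeg⇒pos (p ℚ.* (u ℚ.* u) ℚ.+ q ℚ.* (u ℚ.* w))
    {{ℚ.nonNeg+pos⇒pos (p ℚ.* (u ℚ.* u)) (q ℚ.* (u ℚ.* w))}} (r ℚ.* (w ℚ.* w))
  where
  instance
    _ = ℚ.nonNeg*nonNeg⇒nonNeg p {{p≥0}} (u ℚ.* u) {{square-nonNegative u}}
    _ = ℚ.pos*pos⇒pos q {{q>0}} (u ℚ.* w) {{uw>0}}
    _ = ℚ.nonNeg*nonNeg⇒nonNeg r {{r≥0}} (w ℚ.* w) {{square-nonNegative w}}

-- 16u′w′ = (s²-5)(s²-1)u² + ((s²-5)² + (s²-9)(s²-1))uw + (s²-5)(s²-9)w² for the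
-- rotated coordinates (s , u′ , w′).
record PositiveRotation (s : ℚ) : Set where
  constructor positiveRotation
  S : ℕ → ℚ
  S k = s ℚ.* s ℚ.- rational k
  field
    uu≥0 : NonNegative (S 5 ℚ.* S 1)
    uw-coefficient>0 : Positive (S 5 ℚ.* S 5 ℚ.+ S 9 ℚ.* S 1)
    ww≥0 : NonNegative (S 5 ℚ.* S 9)

rotate-positive : ∀ s u w → PositiveRotation s → Positive (u ℚ.* w) →
  let v = rotate (s ∷ u ∷ w ∷ []) in Positive (lookup v 1F ℚ.* lookup v 2F)
rotate-positive s u w rot uw>0 = ≡.subst Positive
  (ℚ-solve
    (Κ (+ 1 ℚ./ 16) ⊗ ((Sᵉ 5 ⊗ Sᵉ 1) ⊗ (Ι 1F ⊗ Ι 1F) ⊕ (Sᵉ 5 ⊗ Sᵉ 5 ⊕ Sᵉ 9 ⊗ Sᵉ 1) ⊗ (Ι 1F ⊗ Ι 2F)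
      ⊕ (Sᵉ 5 ⊗ Sᵉ 9) ⊗ (Ι 2F ⊗ Ι 2F)))
    (lookup rotation 1F ⊗ lookup rotation 2F) (s ∷ u ∷ w ∷ []) refl)
  (ℚ.pos*pos⇒pos (+ 1 ℚ./ 16) (form u w) {{form>0}})
  where
  open PositiveRotation rot
  Sᵉ : ℕ → Expr ℚ 3
  Sᵉ k = Ι 0F ⊗ Ι 0F ⊕ ⊝ Κ (rational k)
  form : ℚ → ℚ → ℚ
  form u w = (S 5 ℚ.* S 1) ℚ.* (u ℚ.* u) ℚ.+ (S 5 ℚ.* S 5 ℚ.+ S 9 ℚ.* S 1) ℚ.* (u ℚ.* w)
         ℚ.+ (S 5 ℚ.* S 9) ℚ.* (w ℚ.* w)
  form>0 : Positive (form u w)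
  form>0 = quadraticForm-positive (S 5 ℚ.* S 1) (S 5 ℚ.* S 5 ℚ.+ S 9 ℚ.* S 1) (S 5 ℚ.* S 9) u w
    uu≥0 uw-coefficient>0 ww≥0 uw>0

-- The product uw need only be positive after one rotation.
record Admissible (v : Vec ℚ 3) : Set where
  constructor admissible
  field
    s+3≢0 : lookup v 0F ℚ.+ rational 3 ≢ 0ℚ
    u≢0   : lookup v 1F ≢ 0ℚ
    u+w≢0 : lookup v 1F ℚ.+ lookup v 2F ≢ 0ℚ
    positive-s  : PositiveRotation (lookup v 0F)
    rotated>0 : Positive (lookup (rotate v) 1F ℚ.* lookup (rotate v) 2F)

rotate-admissible : ∀ {v} → Admissible v → Admissible (rotate v)
rotate-admissible {s ∷ u ∷ w ∷ []} (admissible s+3≢0 u≢0 u+w≢0 rot u′w′>0) =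
  admissible s+3≢0 (product-positive⇒u≢0 u′ w′ u′w′>0) (product-positive⇒u+w≢0 u′ w′ u′w′>0) rot
    (rotate-positive s u′ w′ rot u′w′>0)
  where
  u′ w′ : ℚ
  u′ = lookup (rotate (s ∷ u ∷ w ∷ [])) 1F
  w′ = lookup (rotate (s ∷ u ∷ w ∷ [])) 2F

-- The coordinates (s , u , w) of basePoint ε δ.
fibrePoint : Bool → Bool → Vec ℚ 3
fibrePoint true  true  = rational 6 ∷ ½ ∷ + 1 ℚ./ 6 ∷ []
fibrePoint true  false = ℚ.- 1ℚ ∷ ½ ∷ ℚ.- 1ℚ ∷ []
fibrePoint false true  = 1ℚ ∷ ½ ∷ 1ℚ ∷ []
fibrePoint false false = ℚ.- (rational 6) ∷ ½ ∷ ℚ.- (+ 1 ℚ./ 6) ∷ []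

-- The three coefficients are 0, 16, 32 for s² = 1 and all positive for s² = 36. As s w = b + c = 1
-- and u = ½, a negative s makes u w negative at the start; there u + w is -½ or 1/3, and the first
-- rotation already makes the product positive.
fibrePoint-admissible : ∀ ε δ → Admissible (fibrePoint ε δ)
fibrePoint-admissible true  true  = admissible (λ ()) (λ ()) (λ ()) (positiveRotation _ _ _) _
fibrePoint-admissible true  false = admissible (λ ()) (λ ()) (λ ()) (positiveRotation _ _ _) _
fibrePoint-admissible false true  = admissible (λ ()) (λ ()) (λ ()) (positiveRotation _ _ _) _
fibrePoint-admissible false false = admissible (λ ()) (λ ()) (λ ()) (positiveRotation _ _ _) _

private module ℚ-Fibration where
  open Fibration ℚ-algebra public
  open Values ℚ-algebra public

module _ {A B : ℚ-Algebra} (h : A ⟶ B) where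
  private
    module A where
      open ℚ-Algebra A public
      open Fibration A public
    module B where
      open ℚ-Algebra B public
      open Fibration B public
    open _⟶_ h

  rotations-homo : ∀ n {v v′} → (∀ i → ⟦ lookup v i ⟧ B.≈ lookup v′ i) →
                   ∀ i → ⟦ lookup (A.rotations n v) i ⟧ B.≈ lookup (B.rotations n v′) i
  rotations-homo zero    v~v′ = v~v′
  rotations-homo (suc n) {v} {v′} v~v′ i = ≡.subst₂ (λ x y → ⟦ x ⟧ B.≈ y)
    (≡.sym (lookup-map i (λ e → A.⟦ e ⟧ (A.rotations n v)) rotation))
    (≡.sym (lookup-map i (λ e → B.⟦ e ⟧ (B.rotations n v′)) rotation))
    (eval-homo (lookup rotation i) {A.rotations n v} {B.rotations n v′} (rotations-homo n v~v′))

rotations-admissible : ∀ n {v} → Admissible v → Admissible (ℚ-Fibration.rotations n v)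
rotations-admissible zero    adm = adm
rotations-admissible (suc n) adm = rotate-admissible (rotations-admissible n adm)

-- The orbit of the generic point

module GenericOrbit (embedding : Embedding) where
  private
    module B where
      open Embedding embedding public
      open Fibration algebra public
      open RegularElements algebra public
    open B using (algebra; generic)
    open Values algebra
    open Solver algebra
    module e (ε δ : Bool) = _⟶_ (B.evaluation ε δ)

    a b c d u s w : B.Carrier
    a = lookup generic 0F
    b = lookup generic 1F
    c = lookup generic 2F
    d = lookup generic 3F
    u = c B.- b
    -- The ratio is an element of the ring because u was made invertible there.
    s = (a B.+ d) B.* B.u⁻¹
    w = B.κ (+ 1 ℚ./ 3) B.* (d B.- a)

    fibre : Vec B.Carrier 3
    fibre = s ∷ u ∷ w ∷ []

    u-regular : u B.Regular
    u-regular = B.unit-regular B.u-inverse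

    s-ratio : s B.* u B.≈ a B.+ d
    s-ratio = B.≈-trans
      (solve (Ι 0F ⊗ Ι 1F ⊗ Ι 2F) (Ι 0F ⊗ (Ι 2F ⊗ Ι 1F)) (a B.+ d ∷ B.u⁻¹ ∷ u ∷ []) refl)
      (B.≈-trans (B.*-cong B.≈-refl B.u-inverse) (B.*-identityʳ _))

    onX₄′ : OnX₄ algebra (a ∷ b ∷ c ∷ d ∷ [])
    onX₄′ = B.generic-onX₄

    evaluation-fibre : ∀ ε δ i → e.⟦_⟧ ε δ (lookup fibre i) ≡ lookup (fibrePoint ε δ) i
    -- The image of u⁻¹ under evaluation is not among the data; s is recovered from s u = a + d by
    -- cancelling the value ½ of u.
    evaluation-fibre ε δ 0F = RegularElements.regular-cancel ℚ-algebra {½} (ℚ-regular {½} λ ())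
      (≡.trans (ℚ.*-comm ½ (e.⟦_⟧ ε δ s))
      (≡.trans (≡.cong (e.⟦_⟧ ε δ s ℚ.*_) (≡.sym (evaluation-u ε δ)))
      (≡.trans (≡.sym (e.*-homo ε δ s u))
      (≡.trans (e.cong ε δ s-ratio)
      (≡.trans (e.eval-homo ε δ (Defs.a ⊕ Defs.d) {generic} {basePoint ε δ} (B.evaluation-generic ε δ))
        (value ε δ))))))
      where
      evaluation-u : ∀ ε δ → e.⟦_⟧ ε δ u ≡ ½
      evaluation-u ε δ = e.eval-homo ε δ uᵖ {generic} {basePoint ε δ} (B.evaluation-generic ε δ)
      value : ∀ ε δ → signed ε (+ 5 ℚ./ 4) ℚ.+ signed δ (+ 7 ℚ./ 4) ≡ ½ ℚ.* lookup (fibrePoint ε δ) 0F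
      value true  true  = refl
      value true  false = refl
      value false true  = refl
      value false false = refl
    evaluation-fibre ε δ 1F = ≡.trans
      (e.eval-homo ε δ uᵖ {generic} {basePoint ε δ} (B.evaluation-generic ε δ)) (value ε δ)
      where
      value : ∀ ε δ → ½ ≡ lookup (fibrePoint ε δ) 1F
      value true  true  = refl
      value true  false = refl
      value false true  = refl
      value false false = refl
    evaluation-fibre ε δ 2F = ≡.trans
      (e.eval-homo ε δ wᵖ {generic} {basePoint ε δ} (B.evaluation-generic ε δ)) (value ε δ)
      where
      value : ∀ ε δ → + 1 ℚ./ 3 ℚ.* (signed δ (+ 7 ℚ./ 4) ℚ.- signed ε (+ 5 ℚ./ 4)) ≡ lookup (fibrePoint ε δ) 2F
      value true  true  = refl
      value true  false = refl
      value false true  = refl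
      value false false = refl

    rotations-nondegenerate : ∀ n → B.Nondegenerate (B.rotations n fibre)
    rotations-nondegenerate n = B.nondegenerate
      (regular (Ι 1F) λ ε δ → Admissible.u≢0 (adm ε δ))
      (regular (Ι 0F ⊕ nat 3) λ ε δ → Admissible.s+3≢0 (adm ε δ))
      (regular (Ι 1F ⊕ Ι 2F) λ ε δ → Admissible.u+w≢0 (adm ε δ))
      where
      point : Bool → Bool → Vec ℚ 3
      point ε δ = ℚ-Fibration.rotations n (fibrePoint ε δ)
      adm : ∀ ε δ → Admissible (point ε δ)
      adm ε δ = rotations-admissible n (fibrePoint-admissible ε δ)
      regular : ∀ f → (∀ ε δ → ℚ-Algebra.⟦_⟧ ℚ-algebra f (point ε δ) ≢ 0ℚ) →
                B.⟦ f ⟧ (B.rotations n fibre) B.Regular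
      regular f f≢0 = B.regular _ λ ε δ f≡0 → f≢0 ε δ (≡.trans (≡.sym
        (e.eval-homo ε δ f {B.rotations n fibre} {point ε δ}
          (rotations-homo (B.evaluation ε δ) n {fibre} {fibrePoint ε δ} (evaluation-fibre ε δ)))) f≡0)

    rotations-conic : ∀ n → B.OnConic (B.rotations n fibre)
    rotations-conic zero    = B.fibre-conic onX₄′ u-regular s-ratio
    rotations-conic (suc n) = B.rotation-conic {B.rotations n fibre} (rotations-conic n)

    -- Together with the value, the induction carries the regularity of every denominator of the
    -- composite, so no iterate degenerates on a component of X₄.
    ζ-iterate-at : ∀ n → Defs.ζ ⁽ n ⁾ at generic ≔* B.⟦ parametrization ⟧* (B.rotations n fibre)
    ζ-iterate-at zero i = at-resp (B.≈-sym (B.fibre-point onX₄′ u-regular s-ratio i)) (identity i)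
      where
      identity : Defs.idᵣ at generic ≔* (a ∷ b ∷ c ∷ d ∷ [])
      identity 0F = polynomial-at Defs.a
      identity 1F = polynomial-at Defs.b
      identity 2F = polynomial-at Defs.c
      identity 3F = polynomial-at Defs.d
    ζ-iterate-at (suc n) = ⊚-at {F = Defs.ζ} {G = Defs.ζ ⁽ n ⁾}
      {v = B.⟦ parametrization ⟧* (B.rotations n fibre)}
      {v′ = B.⟦ parametrization ⟧* (B.rotations (suc n) fibre)}
      (B.ζ-at {B.rotations n fibre} (rotations-conic n) (rotations-nondegenerate n)) (ζ-iterate-at n)

    fibreCoordinates₀-at : fibreCoordinates 0 at generic ≔* fibre
    fibreCoordinates₀-at 0F = u-regular , B.≈-sym s-ratio
    fibreCoordinates₀-at 1F = polynomial-at uᵖ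
    fibreCoordinates₀-at 2F = polynomial-at wᵖ

  iterate-≋ : ∀ n → iterate n Defs.≋ (Defs.ζ ⁽ n ⁾)
  iterate-≋ n i = Density.same-value⇒∼ embedding
    (B.iterate-at {v = fibre} n fibreCoordinates₀-at i) (ζ-iterate-at n i)

open import Data.Integer.Base using (ℤ)
open import Data.Nat.Base using (_+_; _*_)
open import Data.Product.Base using (Σ)
open import Defs using (PolynomialOfDegree; evaluate; ζ; _⁽_⁾; line; ι; _at_hasValue_)

-- Degrees along the line

-- The leading coefficient l may be zero: n is only a formal degree.
data PolynomialFunction (l : ℚ) : ℕ → (ℚ → ℚ) → Set where
  constant : ∀ {f} → (∀ x → f x ≡ l) → PolynomialFunction l 0 f
  horner   : ∀ {n f g} k → PolynomialFunction l n g → (∀ x → f x ≡ k ℚ.+ x ℚ.* g x) →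
             PolynomialFunction l (suc n) f

resp-≗ : ∀ {l n f g} → (∀ x → f x ≡ g x) → PolynomialFunction l n f → PolynomialFunction l n g
resp-≗ f≗g (constant f≗l)   = constant λ x → ≡.trans (≡.sym (f≗g x)) (f≗l x)
resp-≗ f≗g (horner k p f≗) = horner k p λ x → ≡.trans (≡.sym (f≗g x)) (f≗ x)

add : ∀ {l m n f g} → PolynomialFunction l n f → PolynomialFunction m n g →
      PolynomialFunction (l ℚ.+ m) n (λ x → f x ℚ.+ g x)
add (constant f≗l) (constant g≗m) = constant λ x → ≡.cong₂ ℚ._+_ (f≗l x) (g≗m x)
add (horner {g = f′} k p f≗) (horner {g = g′} j q g≗) = horner (k ℚ.+ j) (add p q) λ x →
  ≡.trans (≡.cong₂ ℚ._+_ (f≗ x) (g≗ x))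
    (ℚ-solve ((Ι 0F ⊕ Ι 4F ⊗ Ι 1F) ⊕ (Ι 2F ⊕ Ι 4F ⊗ Ι 3F)) ((Ι 0F ⊕ Ι 2F) ⊕ Ι 4F ⊗ (Ι 1F ⊕ Ι 3F))
      (k ∷ f′ x ∷ j ∷ g′ x ∷ x ∷ []) refl)

scale : ∀ r {l n f} → PolynomialFunction l n f → PolynomialFunction (r ℚ.* l) n (λ x → r ℚ.* f x)
scale r (constant f≗l) = constant λ x → ≡.cong (r ℚ.*_) (f≗l x)
scale r (horner {g = g} k p f≗) = horner (r ℚ.* k) (scale r p) λ x →
  ≡.trans (≡.cong (r ℚ.*_) (f≗ x))
    (ℚ-solve (Ι 0F ⊗ (Ι 1F ⊕ Ι 2F ⊗ Ι 3F)) (Ι 0F ⊗ Ι 1F ⊕ Ι 2F ⊗ (Ι 0F ⊗ Ι 3F))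
      (r ∷ k ∷ x ∷ g x ∷ []) refl)

shift : ∀ {l n f} → PolynomialFunction l n f → PolynomialFunction l (suc n) (λ x → x ℚ.* f x)
shift p = horner 0ℚ p λ x → ≡.sym (ℚ.+-identityˡ _)

-- Since `add` wants equal formal degrees, a summand of lower degree is padded with leading zeros
-- first.
pad : ∀ {l n f} → PolynomialFunction l n f → PolynomialFunction 0ℚ (suc n) f
pad {l} (constant f≗l) = horner l (constant {f = λ _ → 0ℚ} λ _ → refl) λ x →
  ≡.trans (f≗l x) (≡.sym (≡.trans (≡.cong (l ℚ.+_) (ℚ.*-zeroʳ x)) (ℚ.+-identityʳ l)))
pad (horner k p f≗) = horner k (pad p) f≗

toPolynomial : ∀ {l n f} → l ≢ 0ℚ → PolynomialFunction l n f →
               Σ (PolynomialOfDegree n) λ p → ∀ x → evaluate p x ≡ f x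
toPolynomial {l} l≢0 p = record
  { coefficients = coefficients p
  ; leading≢0    = λ last≡0 → l≢0 (≡.trans (≡.sym (last-coefficient p)) last≡0) } , evaluate-coefficients p
  where
  coefficients : ∀ {n f} → PolynomialFunction l n f → Vec ℚ (suc n)
  coefficients (constant _)   = l ∷ []
  coefficients (horner k p _) = k ∷ coefficients p

  last-∷ : ∀ {n} k (v : Vec ℚ (suc n)) → last (k ∷ v) ≡ last v
  last-∷ k (x ∷ v) = refl

  last-coefficient : ∀ {n f} (p : PolynomialFunction l n f) → last (coefficients p) ≡ l
  last-coefficient (constant _)   = refl
  last-coefficient (horner k p _) = ≡.trans (last-∷ k (coefficients p)) (last-coefficient p)

  evaluate-coefficients : ∀ {n f} (p : PolynomialFunction l n f) x →
    foldr (λ _ → ℚ) (λ k r → k ℚ.+ x ℚ.* r) 0ℚ (coefficients p) ≡ f x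
  evaluate-coefficients (constant f≗l) x =
    ≡.trans (≡.trans (≡.cong (l ℚ.+_) (ℚ.*-zeroʳ x)) (ℚ.+-identityʳ l)) (≡.sym (f≗l x))
  evaluate-coefficients (horner k p f≗) x =
    ≡.trans (≡.cong (λ y → k ℚ.+ x ℚ.* y) (evaluate-coefficients p x)) (≡.sym (f≗ x))

lineFibre : ℚ → Vec ℚ 3
lineFibre x = rational 2 ℚ.* x ℚ.+ rational 3 ∷ 1ℚ ∷ 1ℚ ∷ []

-- s² - k = 4 x² + 12 x + (9 - k), of which only the first term reaches the top degree.
multiply-quadratic : ∀ k {l n f} → PolynomialFunction l n f →
  let s = λ x → rational 2 ℚ.* x ℚ.+ rational 3 in
  PolynomialFunction (rational 4 ℚ.* l) (suc (suc n)) (λ x → (s x ℚ.* s x ℚ.- k) ℚ.* f x)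
multiply-quadratic k {l} {f = f} p = ≡.subst (λ l → PolynomialFunction l _ _)
  (ℚ-solve (nat 4 ⊗ Ι 0F ⊕ (nat 12 ⊗ Κ 0ℚ ⊕ (nat 9 ⊕ ⊝ Ι 1F) ⊗ Κ 0ℚ))
    (nat 4 ⊗ Ι 0F) (l ∷ k ∷ []) refl)
  (resp-≗ (λ x → ℚ-solve
      (nat 4 ⊗ (Ι 0F ⊗ (Ι 0F ⊗ Ι 2F))
        ⊕ (nat 12 ⊗ (Ι 0F ⊗ Ι 2F) ⊕ (nat 9 ⊕ ⊝ Ι 1F) ⊗ Ι 2F))
      (((nat 2 ⊗ Ι 0F ⊕ nat 3) ⊗ (nat 2 ⊗ Ι 0F ⊕ nat 3) ⊕ ⊝ Ι 1F) ⊗ Ι 2F)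
      (x ∷ k ∷ f x ∷ []) refl)
    (add (scale (rational 4) (shift (shift p)))
      (add (scale (rational 12) (pad (shift p))) (scale (rational 9 ℚ.- k) (pad (pad p))))))

-- Because u and w share the leading coefficient l, the top terms add up to ¼ (4 l + 4 l) = 2 l and
-- cannot cancel; j and k affect lower terms only. Both coordinates are therefore followed together.
rotate-polynomial : ∀ j k {l n f g} → PolynomialFunction l n f → PolynomialFunction l n g →
  let s = λ x → rational 2 ℚ.* x ℚ.+ rational 3 in
  PolynomialFunction (rational 2 ℚ.* l) (suc (suc n))
    (λ x → (+ 1 ℚ./ 4) ℚ.* ((s x ℚ.* s x ℚ.- j) ℚ.* f x ℚ.+ (s x ℚ.* s x ℚ.- k) ℚ.* g x))
rotate-polynomial j k {l} p q = ≡.subst (λ l → PolynomialFunction l _ _)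
  (ℚ-solve (Κ (+ 1 ℚ./ 4) ⊗ (nat 4 ⊗ Ι 0F ⊕ nat 4 ⊗ Ι 0F)) (nat 2 ⊗ Ι 0F) (l ∷ []) refl)
  (scale (+ 1 ℚ./ 4) (add (multiply-quadratic j p) (multiply-quadratic k q)))

-- The factor s contributes 2 x, giving ½ · 2 l = l, while k g has lower degree; so all four
-- coordinates have the same leading coefficient.
parametrization-polynomial : ∀ k {l n f g} → PolynomialFunction l n f → PolynomialFunction l n g →
  PolynomialFunction l (suc n)
    (λ x → ½ ℚ.* ((rational 2 ℚ.* x ℚ.+ rational 3) ℚ.* f x ℚ.+ k ℚ.* g x))
parametrization-polynomial k {l} {f = f} {g} p q = ≡.subst (λ l → PolynomialFunction l _ _)
  (ℚ-solve (Κ ½ ⊗ ((nat 2 ⊗ Ι 0F ⊕ nat 3 ⊗ Κ 0ℚ) ⊕ Ι 1F ⊗ Κ 0ℚ)) (Ι 0F) (l ∷ k ∷ []) refl)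
  (resp-≗ (λ x → ℚ-solve
      (Κ ½ ⊗ ((nat 2 ⊗ (Ι 0F ⊗ Ι 1F) ⊕ nat 3 ⊗ Ι 1F) ⊕ Ι 2F ⊗ Ι 3F))
      (Κ ½ ⊗ ((nat 2 ⊗ Ι 0F ⊕ nat 3) ⊗ Ι 1F ⊕ Ι 2F ⊗ Ι 3F))
      (x ∷ f x ∷ k ∷ g x ∷ []) refl)
    (scale ½ (add (add (scale (rational 2) (shift p)) (scale (rational 3) (pad p))) (scale k (pad q)))))

-- Iterates on the line

open ℚ-Fibration using (rotations; ⟦_⟧*; _,_; _at_≔_; _at_≔*_; at-resp; polynomial-at; den-regular; num-value; iterate-at)

orbit : ℕ → ℚ → Vec ℚ 3
orbit n x = rotations n (lineFibre x)

orbit-s : ∀ n x → lookup (orbit n x) 0F ≡ rational 2 ℚ.* x ℚ.+ rational 3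
orbit-s zero    x = refl
orbit-s (suc n) x = orbit-s n x

leading : ℕ → ℚ
leading zero    = 1ℚ
leading (suc n) = rational 2 ℚ.* leading n

leading≢0 : ∀ n → leading n ≢ 0ℚ
leading≢0 zero    = λ ()
leading≢0 (suc n) = *-≢0 {rational 2} (λ ()) (leading≢0 n)

orbit-polynomial : ∀ n → PolynomialFunction (leading n) (2 * n) (λ x → lookup (orbit n x) 1F)
                       × PolynomialFunction (leading n) (2 * n) (λ x → lookup (orbit n x) 2F)
orbit-polynomial zero    = constant (λ _ → refl) , constant (λ _ → refl)
orbit-polynomial (suc n) = step (orbit-polynomial n)
  where
  rotated : ℚ → ℚ → ℚ → ℚ → ℚ → ℚ
  rotated j k s u w = (+ 1 ℚ./ 4) ℚ.* ((s ℚ.* s ℚ.- j) ℚ.* u ℚ.+ (s ℚ.* s ℚ.- k) ℚ.* w)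
  coordinate : ∀ j k {l f g} → PolynomialFunction l (2 * n) f → PolynomialFunction l (2 * n) g →
    PolynomialFunction (rational 2 ℚ.* l) (2 * suc n) (λ x → rotated j k (lookup (orbit n x) 0F) (f x) (g x))
  coordinate j k {l} {f} {g} p q =
    ≡.subst (λ m → PolynomialFunction (rational 2 ℚ.* l) m (λ x → rotated j k (lookup (orbit n x) 0F) (f x) (g x)))
      (≡.sym (ℕ.*-suc 2 n))
      (resp-≗ (λ x → ≡.cong (λ s → rotated j k s (f x) (g x)) (≡.sym (orbit-s n x)))
        (rotate-polynomial j k p q))
  step : _ → _
  step (p , q) = coordinate (rational 5) (rational 9) p q , coordinate (rational 1) (rational 5) p q

point-polynomial : ∀ n i → PolynomialFunction (leading n) (2 * n + 1)
                             (λ x → lookup (⟦ parametrization ⟧* (orbit n x)) i)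
point-polynomial n i = ≡.subst
  (λ m → PolynomialFunction (leading n) m (λ x → lookup (⟦ parametrization ⟧* (orbit n x)) i))
  (ℕ.+-comm 1 (2 * n)) (coordinate i)
  where
  combination : ℚ → ℚ → ℚ → ℚ → ℚ
  combination k s u w = ½ ℚ.* (s ℚ.* u ℚ.+ k ℚ.* w)
  negate : ∀ k s u w → combination (ℚ.- k) s u w ≡ ½ ℚ.* (s ℚ.* u ℚ.- k ℚ.* w)
  negate k s u w = ℚ-solve (Κ ½ ⊗ (Ι 1F ⊗ Ι 2F ⊕ ⊝ Ι 0F ⊗ Ι 3F)) (Κ ½ ⊗ (Ι 1F ⊗ Ι 2F ⊕ ⊝ (Ι 0F ⊗ Ι 3F)))
    (k ∷ s ∷ u ∷ w ∷ []) refl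
  u w s : ℚ → ℚ
  s x = lookup (orbit n x) 0F
  u x = lookup (orbit n x) 1F
  w x = lookup (orbit n x) 2F
  with-orbit-s : ∀ k {f g} → PolynomialFunction (leading n) (2 * n) f → PolynomialFunction (leading n) (2 * n) g →
    PolynomialFunction (leading n) (suc (2 * n)) (λ x → combination k (s x) (f x) (g x))
  with-orbit-s k {f} {g} p q = resp-≗ (λ x → ≡.cong (λ s → combination k s (f x) (g x)) (≡.sym (orbit-s n x)))
    (parametrization-polynomial k p q)
  coordinate : ∀ i → PolynomialFunction (leading n) (suc (2 * n))
                       (λ x → lookup (⟦ parametrization ⟧* (orbit n x)) i)
  coordinate 0F = resp-≗ (λ x → negate (rational 3) (s x) (u x) (w x))
    (with-orbit-s (ℚ.- rational 3) (proj₁ (orbit-polynomial n)) (proj₂ (orbit-polynomial n)))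
  coordinate 1F = resp-≗ (λ x → ≡.trans (negate 1ℚ (s x) (w x) (u x))
      (≡.cong (λ y → ½ ℚ.* (s x ℚ.* w x ℚ.- y)) (ℚ.*-identityˡ (u x))))
    (with-orbit-s (ℚ.- 1ℚ) (proj₂ (orbit-polynomial n)) (proj₁ (orbit-polynomial n)))
  coordinate 2F = resp-≗ (λ x → ≡.cong (λ y → ½ ℚ.* (s x ℚ.* w x ℚ.+ y)) (ℚ.*-identityˡ (u x)))
    (with-orbit-s 1ℚ (proj₂ (orbit-polynomial n)) (proj₁ (orbit-polynomial n)))
  coordinate 3F = with-orbit-s (rational 3) (proj₁ (orbit-polynomial n)) (proj₂ (orbit-polynomial n))

-- As c - b = 1 everywhere on the line, the denominators of `iterate n` do not vanish there, even at
-- t = -3.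
line-fibreCoordinates : ∀ t → fibreCoordinates 0 at Defs.Point.coords (line t) ≔* lineFibre (ι t)
line-fibreCoordinates t = at-line
  where
  open RegularElements ℚ-algebra
  ρ : Vec ℚ 4
  ρ = Defs.Point.coords (line t)
  ρᵉ : Vec (Expr ℚ 1) 4
  ρᵉ = Ι 0F ∷ Ι 0F ⊕ Κ 1ℚ ∷ Ι 0F ⊕ nat 2 ∷ Ι 0F ⊕ nat 3 ∷ []
  u≡1 : ℚ-Algebra.⟦_⟧ ℚ-algebra uᵖ ρ ≡ 1ℚ
  u≡1 = ℚ-solve (substitute uᵖ ρᵉ) (Κ 1ℚ) (ι t ∷ []) refl
  w≡1 : ℚ-Algebra.⟦_⟧ ℚ-algebra wᵖ ρ ≡ 1ℚ
  w≡1 = ℚ-solve (substitute wᵖ ρᵉ) (Κ 1ℚ) (ι t ∷ []) refl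
  at-line : fibreCoordinates 0 at ρ ≔* lineFibre (ι t)
  at-line 0F = regular-resp (≡.sym u≡1) regular-1
             , ℚ-solve (substitute (Defs.a ⊕ Defs.d) ρᵉ)
                 ((nat 2 ⊗ Ι 0F ⊕ nat 3) ⊗ substitute uᵖ ρᵉ) (ι t ∷ []) refl
  at-line 1F = at-resp u≡1 (polynomial-at uᵖ)
  at-line 2F = at-resp w≡1 (polynomial-at wᵖ)

theorem1p1 : ∀ (n : ℕ) →
  Σ (Vec (PolynomialOfDegree (2 * n + 1)) 4) λ ξ →
    ∀ (t : ℤ) → (ζ ⁽ n ⁾) at line t hasValue map (λ ξᵢ → evaluate ξᵢ (ι t)) ξ
-- The coefficients come from the orbit of the line as a function of x, so one ξ serves all t.
theorem1p1 n = ξ 0F ∷ ξ 1F ∷ ξ 2F ∷ ξ 3F ∷ [] , λ t → iterate n , GenericOrbit.iterate-≋ embedding n , value t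
  where
  embedding : Embedding
  embedding = QuadraticTower.embedding powerSeriesBase
  polynomial : ∀ i → Σ (PolynomialOfDegree (2 * n + 1)) λ p →
                     ∀ x → evaluate p x ≡ lookup (⟦ parametrization ⟧* (orbit n x)) i
  polynomial i = toPolynomial (leading≢0 n) (point-polynomial n i)
  ξ : Fin 4 → PolynomialOfDegree (2 * n + 1)
  ξ i = proj₁ (polynomial i)
  v : ℤ → Vec ℚ 4
  v t = map (λ p → evaluate p (ι t)) (ξ 0F ∷ ξ 1F ∷ ξ 2F ∷ ξ 3F ∷ [])
  v≡ : ∀ t i → lookup (⟦ parametrization ⟧* (orbit n (ι t))) i ≡ lookup (v t) i
  v≡ t 0F = ≡.sym (proj₂ (polynomial 0F) (ι t))
  v≡ t 1F = ≡.sym (proj₂ (polynomial 1F) (ι t))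
  v≡ t 2F = ≡.sym (proj₂ (polynomial 2F) (ι t))
  v≡ t 3F = ≡.sym (proj₂ (polynomial 3F) (ι t))
  regular-≢0 : ∀ {r} → ℚ-Algebra._Regular ℚ-algebra r → r ≢ 0ℚ
  regular-≢0 reg refl with reg 1ℚ refl
  ... | ()
  value : ∀ t i → let f = lookup (iterate n) i in
    Defs.⟦ Defs.Quotient.den f ⟧ (Defs.Point.coords (line t)) ≢ 0ℚ ×
    Defs.⟦ Defs.Quotient.num f ⟧ (Defs.Point.coords (line t)) ≡
      lookup (v t) i ℚ.* Defs.⟦ Defs.Quotient.den f ⟧ (Defs.Point.coords (line t))
  value t i = regular-≢0 (den-regular at-t) , num-value at-t
    where
    at-t : lookup (iterate n) i at Defs.Point.coords (line t) ≔ lookup (v t) i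
    at-t = at-resp (v≡ t i) (iterate-at {v = lineFibre (ι t)} n (line-fibreCoordinates t) i)
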